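{- Fix integers $m,n\ge 1$. For a family $a=(a_1,\dots,a_m)$ of integers in $\mathbb{P}\setminus\{1\}$, let $\mathcal{A}_n(a)$ be the arrangement in $\mathbb{R}^n$ with hyperplanes $x_i=0$ for all $i$; $x_i=x_j$ for all $i<j$; and $x_i=a_l x_j$ for all $i\neq j$ and all $1\le l\le m$. If $a=(a_1,\dots,a_m)$ and $a'=(a'_1,\dots,a'_m)$ are two such families, each consisting of multiplicatively independent integers, then $\chi_{\mathcal{A}_n(a)}(t)=\chi_{\mathcal{A}_n(a')}(t)$. That is, for fixed $m$ and $n$ the characteristic polynomial of $\mathcal{A}_n$ does not depend on the $a_i$'s as long as they are multiplicatively independent.
   Context: $\mathbb{P}$ denotes the set of positive integers. Numbers $a_1,\dots,a_m$ are multiplicatively independent if $a_1^{i_1}\cdots a_m^{i_m}=1$ with integers $i_1,\dots,i_m$ implies $i_1=\cdots=i_m=0$. For a finite hyperplane arrangement $\mathcal{A}$ in $\mathbb{R}^n$, $L(\mathcal{A})$ is the poset of nonempty intersections of subsets of $\mathcal{A}$ (including $\mathbb{R}^n=\hat0$) ordered by reverse inclusion, and the characteristic polynomial is $\chi_{\mathcal{A}}(t)=\sum_{x\in L(\mathcal{A})}\mu(\hat 0,x)t^{\dim x}$ with $\mu$ the Möbius function of $L(\mathcal{A})$.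
   Formalization: The arrangement is taken in rational n-space instead of real n-space, so intersections and their dimensions are computed over the rationals; since all hyperplanes have integer coefficients, the intersection poset and dimensions are the same over the reals. -}

module Defs where

open import Data.Nat as ℕ using (ℕ; zero; suc; _<_; _≤_)
open import Data.Integer as ℤ using (ℤ; +_; -[1+_])
open import Data.Rational as ℚ using (ℚ; 0ℚ; 1ℚ)
open import Data.Fin as Fin using (Fin)
open import Data.Fin.Subset as Sub using (Subset)
open import Data.List as List using (List; []; _∷_; concatMap; allFin)
open import Data.Product using (Σ; ∃; _×_; _,_)
open import Data.Bool using (Bool; true; false; if_then_else_)
open import Relation.Nullary using (¬_; Dec; yes; no)
open import Relation.Nullary.Decidable using (⌊_⌋)
open import Relation.Binary.PropositionalEquality using (_≡_)

sumℚ : ∀ {k} → (Fin k → ℚ) → ℚ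
sumℚ {zero}  f = 0ℚ
sumℚ {suc k} f = f Fin.zero ℚ.+ sumℚ (λ i → f (Fin.suc i))

prodℚ : ∀ {k} → (Fin k → ℚ) → ℚ
prodℚ {zero}  f = 1ℚ
prodℚ {suc k} f = f Fin.zero ℚ.* prodℚ (λ i → f (Fin.suc i))

sumℤ : ∀ {k} → (Fin k → ℤ) → ℤ
sumℤ {zero}  f = + 0
sumℤ {suc k} f = f Fin.zero ℤ.+ sumℤ (λ i → f (Fin.suc i))

ℕ→ℚ : ℕ → ℚ
ℕ→ℚ k = (+ k) ℚ./ 1

ℤ→ℚ : ℤ → ℚ
ℤ→ℚ z = z ℚ./ 1

-- reciprocal of a natural number (junk value 0 at 0; only used for a ≥ 2)
recipℕ : ℕ → ℚ
recipℕ zero    = 0ℚ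
recipℕ (suc t) = (+ 1) ℚ./ (suc t)

zpow : ℕ → ℤ → ℚ
zpow a (+ k)     = ℕ→ℚ (a ℕ.^ k)
zpow a -[1+ k ]  = recipℕ (a ℕ.^ suc k)

MultIndep : ∀ {m} → (Fin m → ℕ) → Set
MultIndep {m} a =
  (e : Fin m → ℤ) → prodℚ (λ l → zpow (a l) (e l)) ≡ 1ℚ → ∀ l → e l ≡ + 0

Point : ℕ → Set
Point n = Fin n → ℚ

Normal : ℕ → Set
Normal n = Fin n → ℤ

-- the hyperplane with normal c is { x | c · x = 0 }
dot : ∀ {n} → Normal n → Point n → ℚ
dot c x = sumℚ (λ i → ℤ→ℚ (c i) ℚ.* x i)

record Arrangement (n : ℕ) : Set where
  constructor arr
  field
    size : ℕ
    hyp  : Fin size → Normal n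
open Arrangement public

Flat : ∀ {n} (A : Arrangement n) → Subset (size A) → Point n → Set
Flat A S x = ∀ i → i Sub.∈ S → dot (hyp A i) x ≡ 0ℚ

_⊆F_ : ∀ {n} {A : Arrangement n} → Subset (size A) → Subset (size A) → Set
_⊆F_ {A = A} S T = ∀ x → Flat A S x → Flat A T x

SameFlat : ∀ {n} (A : Arrangement n) → Subset (size A) → Subset (size A) → Set
SameFlat A S T = (_⊆F_ {A = A} S T) × (_⊆F_ {A = A} T S)

lincomb : ∀ {n d} → (Fin d → ℚ) → (Fin d → Point n) → Point n
lincomb λs b i = sumℚ (λ j → λs j ℚ.* b j i)

HasDim : ∀ {n} → (Point n → Set) → ℕ → Set
HasDim {n} P d = Σ (Fin d → Point n) λ b →
    (∀ j → P (b j))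
  × ((λs : Fin d → ℚ) → (∀ i → lincomb λs b i ≡ 0ℚ) → ∀ j → λs j ≡ 0ℚ)
  × (∀ x → P x → Σ (Fin d → ℚ) λ λs → ∀ i → x i ≡ lincomb λs b i)

-- Intersection poset L(A), Möbius function μ(0̂,-), characteristic polynomial.
--
-- An element of L(A) is a set of the form Flat A S.  An enumeration of L(A)
-- is a family F : Fin r → Subset k such that every intersection equals
-- exactly one Flat A (F j).  The order is reverse inclusion:
-- F i ≤ F j in L(A)  iff  Flat A (F j) ⊆ Flat A (F i).
-- 0̂ is the whole space, i.e. Flat A ∅.
-- χ_A is recorded by its coefficient sequence p : ℕ → ℤ
-- (p e = coefficient of t^e).

record CharPolyData {n} (A : Arrangement n) (p : ℕ → ℤ) : Set where
  field
    r        : ℕ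
    F        : Fin r → Subset (size A)
    complete : ∀ S → Σ (Fin r) λ j → SameFlat A S (F j)
    distinct : ∀ i j → SameFlat A (F i) (F j) → i ≡ j
    le       : Fin r → Fin r → Bool
    le-spec₁ : ∀ i j → le i j ≡ true → _⊆F_ {A = A} (F j) (F i)
    le-spec₂ : ∀ i j → _⊆F_ {A = A} (F j) (F i) → le i j ≡ true
    μ        : Fin r → ℤ
    μ-bot    : ∀ j → SameFlat A (F j) Sub.⊥ → μ j ≡ + 1
    μ-rec    : ∀ j → ¬ SameFlat A (F j) Sub.⊥ →
               sumℤ (λ i → if le i j then μ i else + 0) ≡ + 0
    dim      : Fin r → ℕ
    dim-spec : ∀ j → HasDim (Flat A (F j)) (dim j)
    -- χ_A(t) = Σ_{x ∈ L(A)} μ(0̂,x) t^{dim x}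
    coeff    : ∀ e → p e ≡ sumℤ (λ j → if ⌊ dim j ℕ.≟ e ⌋ then μ j else + 0)

IsCharPoly : ∀ {n} → Arrangement n → (ℕ → ℤ) → Set
IsCharPoly A p = CharPolyData A p

unit : ∀ {n} → Fin n → Normal n
unit i k = if ⌊ k Fin.≟ i ⌋ then + 1 else + 0

-- normal of  x_i = c x_j , i.e. x_i - c x_j = 0
diffN : ∀ {n} → Fin n → ℤ → Fin n → Normal n
diffN i c j k = unit i k ℤ.- (c ℤ.* unit j k)

hypList : ∀ {m} (n : ℕ) → (Fin m → ℕ) → List (Normal n)
hypList {m} n a =
     List.map unit (allFin n)
  List.++ concatMap (λ i → concatMap (λ j →
        (if ⌊ i Fin.<? j ⌋ then diffN i (+ 1) j ∷ [] else [])
      ) (allFin n)) (allFin n)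
  List.++ concatMap (λ i → concatMap (λ j →
        (if ⌊ i Fin.≟ j ⌋ then [] else List.map (λ l → diffN i (+ (a l)) j) (allFin m))
      ) (allFin n)) (allFin n)

𝒜 : ∀ {m} (n : ℕ) → (Fin m → ℕ) → Arrangement n
𝒜 n a = arr (List.length (hypList n a)) (List.lookup (hypList n a))

-- Every hyperplane xᵢ = 0, xᵢ = xⱼ or xᵢ = aₗ xⱼ is an equation between two
-- terms, a term being 0 or a^g xᵢ with g an integer exponent vector.  Such
-- equations are solved by unification: the system given by a set S of
-- hyperplanes has a most general solution σ, whose linear map has image
-- Flat S and fixes Flat S pointwise.  The only test on the numbers aₗ made by
-- the algorithm is whether a^g = a^h, and by multiplicative independence this
-- means g = h.  So the same σ serves every independent family.  Inclusion of
-- flats is syntactic equality after substituting σ, the dimension of a flat is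
-- the number of variables fixed by σ, and χ depends on nothing else.

module Submission where

open import Defs
open import Data.Nat using (ℕ; _≤_)
open import Data.Integer using (ℤ)
open import Data.Fin using (Fin)
open import Data.Product using (Σ; _×_)
open import Relation.Binary.PropositionalEquality using (_≡_)

open import Level using (0ℓ)
open import Algebra.Bundles using (CommutativeRing)
import Algebra.Properties.CommutativeMonoid.Sum as CommutativeMonoidSum
import Algebra.Properties.Semiring.Sum as SemiringSum
open import Data.Bool as Bool using (Bool; true; false; if_then_else_)
open import Data.Bool.Properties using (⇔→≡; ¬-not)
open import Data.Fin as Fin using (punchIn)
open import Data.Fin.Induction using (spo-wellFounded)
open import Data.Fin.Permutation using (permutation)
open import Data.Fin.Properties using (all?; any?; cast-is-id; cast-involutive; punchInᵢ≢i)
open import Data.Fin.Subset as Sub using (Subset)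
open import Data.Fin.Subset.Properties using (_∈?_)
open import Data.Integer as ℤ using (+_; -[1+_])
import Data.Integer.Properties as ℤ
open import Data.Integer.Solver using () renaming (module +-*-Solver to ℤ-Solver)
open import Data.List as List using (List; []; _∷_; _++_; allFin; concatMap; deduplicate; map)
import Data.List.Properties as List
open import Data.List.Membership.Propositional using (_∈_)
open import Data.List.Membership.Propositional.Properties using (∈-++⁺ˡ; ∈-++⁺ʳ; ∈-map⁺; ∈-lookup; ∈-filter⁺; ∈-filter⁻; ∈-allFin)
import Data.List.Relation.Unary.All as All
open import Data.List.Relation.Unary.AllPairs using (AllPairs; _∷_)
open import Data.List.Relation.Unary.Any as Any using (Any)
import Data.List.Relation.Unary.Any.Properties as Any
import Data.List.Relation.Unary.Unique.DecSetoid.Properties as DecUnique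
import Data.List.Relation.Unary.Unique.Propositional.Properties as Unique
open import Data.Maybe using (Maybe; just; nothing)
import Data.Maybe.Properties as Maybe
open import Data.Nat as ℕ using (zero; suc; z≤n; s≤s)
import Data.Nat.Properties as ℕ
open import Data.Product using (_,_; proj₁; proj₂)
import Data.Product.Properties as Product
open import Data.Rational as ℚ using (ℚ; 0ℚ; 1ℚ; toℚᵘ; fromℚᵘ)
import Data.Rational.Properties as ℚ
open import Data.Rational.Solver using () renaming (module +-*-Solver to ℚ-Solver)
open import Data.Rational.Unnormalised as ℚᵘ using (mkℚᵘ; *≡*)
import Data.Rational.Unnormalised.Properties as ℚᵘ
open import Data.Vec as Vec using (Vec; []; _∷_; here; there; lookup; replicate; zipWith; _[_]≔_)
import Data.Vec.Properties as Vec
open import Data.Vec.Functional using (insertAt)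
open import Data.Vec.Functional.Properties using (insertAt-lookup; insertAt-punchIn)
open import Function using (_∘_; id; mk⇔)
open import Induction.WellFounded as WF using (WellFounded; WfRec)
open import Relation.Binary using (DecSetoid; DecidableEquality; IsStrictPartialOrder)
open import Relation.Binary.PropositionalEquality using (_≢_; refl; sym; trans; cong; cong₂; subst; isEquivalence; module ≡-Reasoning)
open import Relation.Nullary using (¬_; Dec; yes; no; contradiction)
open import Relation.Nullary.Decidable using (⌊_⌋; _×-dec_; _→-dec_; ¬?; decidable-stable; map′)

-- `CharPolyData` may enumerate the flats in any order, with any representatives and any bases, so
-- data for two families cannot be compared directly. The comparison splits in two: data for `a` is
-- carried over to `a′` with enumeration, order, `μ` and dimensions untouched, and for a single
-- arrangement the coefficients are shown not to depend on the data. Carrying over makes sense only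
-- if a subset of hyperplanes has the same indices for both families; hence the hyperplanes are
-- listed symbolically, by `n` and `m` alone. Existence needs inclusion of flats, which quantifies
-- over all rational points, to be decidable; this is why equality of terms has to be an effective
-- test. Integer exponents keep terms closed under solving: a^g xᵢ = a^h xⱼ becomes xᵢ = a^(h-g) xⱼ.
-- The remaining case, a^g xᵢ = a^h xᵢ, is either trivial or forces xᵢ = 0.

module Σℤ = CommutativeMonoidSum ℤ.+-0-commutativeMonoid
module Σℚ = SemiringSum (CommutativeRing.semiring ℚ.+-*-commutativeRing)

-- The Möbius function and the characteristic polynomial of an arrangement

sumℤ≡ : ∀ {k} (f : Fin k → ℤ) → sumℤ f ≡ Σℤ.sum f
sumℤ≡ {zero}  f = refl
sumℤ≡ {suc k} f = cong₂ ℤ._+_ {x = f Fin.zero} refl (sumℤ≡ (f ∘ Fin.suc))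

sumℤ-cong : ∀ {k} {f g : Fin k → ℤ} → (∀ i → f i ≡ g i) → sumℤ f ≡ sumℤ g
sumℤ-cong {f = f} {g} eq = trans (sumℤ≡ f) (trans (Σℤ.sum-cong-≗ eq) (sym (sumℤ≡ g)))

sumℤ-permute : ∀ {k l} (f : Fin l → ℤ) (π : Fin k → Fin l) (ρ : Fin l → Fin k) →
  (∀ j → π (ρ j) ≡ j) → (∀ i → ρ (π i) ≡ i) → sumℤ (f ∘ π) ≡ sumℤ f
sumℤ-permute f π ρ πρ ρπ = begin
  sumℤ (f ∘ π)   ≡⟨ sumℤ≡ (f ∘ π) ⟩
  Σℤ.sum (f ∘ π) ≡⟨ Σℤ.sum-permute f (permutation π ρ πρ ρπ) ⟨
  Σℤ.sum f       ≡⟨ sumℤ≡ f ⟨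
  sumℤ f         ∎
  where open ≡-Reasoning

-- Isolates the term at `j` in a Möbius sum, which runs over all `i ≤ j` with `j` included. The
-- crossed form spares removing an index from `Fin k`.
sumℤ-update : ∀ {k} (f g : Fin k → ℤ) j → (∀ i → i ≢ j → f i ≡ g i) →
  sumℤ f ℤ.+ g j ≡ sumℤ g ℤ.+ f j
sumℤ-update {suc k} f g Fin.zero eq = begin
  f₀ ℤ.+ sumℤ (f ∘ Fin.suc) ℤ.+ g₀ ≡⟨ cong (λ s → f₀ ℤ.+ s ℤ.+ g₀) (sumℤ-cong (λ i → eq (Fin.suc i) λ ())) ⟩
  f₀ ℤ.+ G ℤ.+ g₀                  ≡⟨ solve 3 (λ x s y → x :+ s :+ y := y :+ s :+ x) refl f₀ G g₀ ⟩
  g₀ ℤ.+ G ℤ.+ f₀                  ∎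
  where
  open ≡-Reasoning
  open ℤ-Solver
  f₀ = f Fin.zero
  g₀ = g Fin.zero
  G  = sumℤ (g ∘ Fin.suc)
sumℤ-update {suc k} f g (Fin.suc j) eq = begin
  f₀ ℤ.+ sumℤ (f ∘ Fin.suc) ℤ.+ g (Fin.suc j)   ≡⟨ ℤ.+-assoc f₀ _ _ ⟩
  f₀ ℤ.+ (sumℤ (f ∘ Fin.suc) ℤ.+ g (Fin.suc j)) ≡⟨ cong₂ ℤ._+_ (eq Fin.zero λ ())
    (sumℤ-update (f ∘ Fin.suc) (g ∘ Fin.suc) j (λ i i≢j → eq (Fin.suc i) λ { refl → i≢j refl })) ⟩
  g₀ ℤ.+ (sumℤ (g ∘ Fin.suc) ℤ.+ f (Fin.suc j)) ≡⟨ ℤ.+-assoc g₀ _ _ ⟨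
  g₀ ℤ.+ sumℤ (g ∘ Fin.suc) ℤ.+ f (Fin.suc j)   ∎
  where
  open ≡-Reasoning
  f₀ = f Fin.zero
  g₀ = g Fin.zero

subsets : ∀ k → List (Subset k)
subsets zero    = [] ∷ []
subsets (suc k) = map (true ∷_) (subsets k) ++ map (false ∷_) (subsets k)

∈-subsets : ∀ {k} (S : Subset k) → S ∈ subsets k
∈-subsets []          = Any.here refl
∈-subsets (true  ∷ S) = ∈-++⁺ˡ (∈-map⁺ (true ∷_) (∈-subsets S))
∈-subsets (false ∷ S) = ∈-++⁺ʳ (map (true ∷_) (subsets _)) (∈-map⁺ (false ∷_) (∈-subsets S))

-- `AllPairs` relates earlier entries to later ones only, so symmetry covers the case where `j`
-- precedes `i`. Serves to read off that an enumeration by `List.lookup` has no repetitions.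
AllPairs-lookup : ∀ {A : Set} {R : A → A → Set} {xs : List A} → (∀ {x y} → R x y → R y x) →
  AllPairs R xs → ∀ i j → i ≢ j → R (List.lookup xs i) (List.lookup xs j)
AllPairs-lookup sy (r ∷ rs) Fin.zero    Fin.zero    i≢j = contradiction refl i≢j
AllPairs-lookup {xs = x ∷ xs} sy (r ∷ rs) Fin.zero    (Fin.suc j) i≢j = All.lookup r (∈-lookup {xs = xs} j)
AllPairs-lookup {xs = x ∷ xs} sy (r ∷ rs) (Fin.suc i) Fin.zero    i≢j = sy (All.lookup r (∈-lookup {xs = xs} i))
AllPairs-lookup sy (r ∷ rs) (Fin.suc i) (Fin.suc j) i≢j = AllPairs-lookup sy rs i j (i≢j ∘ cong Fin.suc)

-- Flats under inclusion: uniqueness and existence of the characteristic polynomial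

module IntersectionPoset {n} (A : Arrangement n) where

  infix 4 _⊑_ _≈_
  _⊑_ _≈_ : Subset (size A) → Subset (size A) → Set
  _⊑_ = _⊆F_ {A = A}
  _≈_ = SameFlat A

  ⊑-trans : ∀ {S T U} → S ⊑ T → T ⊑ U → S ⊑ U
  ⊑-trans p q x = q x ∘ p x

  ≈-refl : ∀ {S} → S ≈ S
  ≈-refl = (λ _ → id) , (λ _ → id)

  ≈-sym : ∀ {S T} → S ≈ T → T ≈ S
  ≈-sym (p , q) = q , p

  ≈-trans : ∀ {S T U} → S ≈ T → T ≈ U → S ≈ U
  ≈-trans {S} {T} {U} (p , q) (p′ , q′) = ⊑-trans {S} {T} {U} p p′ , ⊑-trans {U} {T} {S} q′ q

  module Enumeration
    {r : ℕ} (F : Fin r → Subset (size A))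
    (complete : ∀ S → Σ (Fin r) λ j → S ≈ F j)
    (distinct : ∀ i j → F i ≈ F j → i ≡ j)
    (le : Fin r → Fin r → Bool)
    (le-spec₁ : ∀ i j → le i j ≡ true → F j ⊑ F i)
    (le-spec₂ : ∀ i j → F j ⊑ F i → le i j ≡ true)
    where

    infix 4 _⊏_
    _⊏_ : Fin r → Fin r → Set
    i ⊏ j = le i j ≡ true × i ≢ j

    ⊏-isStrictPartialOrder : IsStrictPartialOrder _≡_ _⊏_
    ⊏-isStrictPartialOrder = record
      { isEquivalence = isEquivalence
      ; irrefl        = λ i≡j i⊏j → proj₂ i⊏j i≡j
      ; trans         = λ {i} {j} {k} (i≤j , i≢j) (j≤k , _) →
          le-spec₂ i k (⊑-trans {F k} {F j} {F i} (le-spec₁ j k j≤k) (le-spec₁ i j i≤j)) ,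
          -- If `k` were `i`, then `i ≤ j ≤ i`, so `i` and `j` would index the same flat.
          λ { refl → i≢j (distinct i j (le-spec₁ j i j≤k , le-spec₁ i j i≤j)) }
      ; <-resp-≈      = (λ { refl → id }) , (λ { refl → id })
      }

    ⊏-wellFounded : WellFounded _⊏_
    ⊏-wellFounded = spo-wellFounded ⊏-isStrictPartialOrder

    le-refl : ∀ j → le j j ≡ true
    le-refl j = le-spec₂ j j λ _ → id

    -- No test on points is needed: `complete` names the index of the whole space, and by `distinct`
    -- only that index qualifies.
    bottom? : ∀ j → Dec (F j ≈ Sub.⊥)
    bottom? j with complete Sub.⊥
    ... | b , ⊥≈Fb with j Fin.≟ b
    ...   | yes refl = yes (≈-sym {Sub.⊥} {F b} ⊥≈Fb)
    ...   | no  j≢b  = no λ Fj≈⊥ → j≢b (distinct j b (≈-trans {F j} {Sub.⊥} {F b} Fj≈⊥ ⊥≈Fb))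

    _⊏?_ : ∀ i j → Dec (i ⊏ j)
    i ⊏? j = (le i j Bool.≟ true) ×-dec ¬? (i Fin.≟ j)

    -- Extension by zero of the values strictly below `j`, which lets the recursion sum over all of
    -- `Fin r`.
    below : ∀ j → WfRec _⊏_ (λ _ → ℤ) j → Fin r → ℤ
    below j IH i with i ⊏? j
    ... | yes i⊏j = IH i⊏j
    ... | no  _   = + 0

    below-cong : ∀ j {IH IH′ : WfRec _⊏_ (λ _ → ℤ) j} → (∀ {i} (i⊏j : i ⊏ j) → IH i⊏j ≡ IH′ i⊏j) →
      ∀ i → below j IH i ≡ below j IH′ i
    below-cong j {IH} {IH′} eq i with i ⊏? j
    ... | yes i⊏j = eq i⊏j
    ... | no  _   = refl

    step : ∀ j → WfRec _⊏_ (λ _ → ℤ) j → ℤ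
    step j IH with bottom? j
    ... | yes _ = + 1
    ... | no  _ = ℤ.- sumℤ (below j IH)

    -- Unfolding the well-founded recursion requires that `step` depend only on the values of the
    -- recursive calls.
    step-cong : ∀ j {IH IH′ : WfRec _⊏_ (λ _ → ℤ) j} → (∀ {i} (i⊏j : i ⊏ j) → IH i⊏j ≡ IH′ i⊏j) →
      step j IH ≡ step j IH′
    step-cong j {IH} {IH′} eq with bottom? j
    ... | yes _ = refl
    ... | no  _ = cong ℤ.-_ (sumℤ-cong (below-cong j {IH} {IH′} eq))

    step-bottom : ∀ j (IH : WfRec _⊏_ (λ _ → ℤ) j) → F j ≈ Sub.⊥ → step j IH ≡ + 1
    step-bottom j IH Fj≈⊥ with bottom? j
    ... | yes _    = refl
    ... | no  Fj≉⊥ = contradiction Fj≈⊥ Fj≉⊥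

    step-nonbottom : ∀ j (IH : WfRec _⊏_ (λ _ → ℤ) j) → ¬ F j ≈ Sub.⊥ → step j IH ≡ ℤ.- sumℤ (below j IH)
    step-nonbottom j IH Fj≉⊥ with bottom? j
    ... | yes Fj≈⊥ = contradiction Fj≈⊥ Fj≉⊥
    ... | no  _    = refl

    μ : Fin r → ℤ
    μ = WF.All.wfRec ⊏-wellFounded 0ℓ (λ _ → ℤ) step

    open WF.FixPoint ⊏-wellFounded (λ _ → ℤ) step (λ j {IH} {IH′} → step-cong j {IH} {IH′}) using (unfold-wfRec)

    μ-bottom : ∀ j → F j ≈ Sub.⊥ → μ j ≡ + 1
    μ-bottom j Fj≈⊥ = trans (unfold-wfRec {j}) (step-bottom j _ Fj≈⊥)

    μ-rec : ∀ j → ¬ F j ≈ Sub.⊥ → sumℤ (λ i → if le i j then μ i else + 0) ≡ + 0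
    μ-rec j Fj≉⊥ = begin
      sumℤ f               ≡⟨ ℤ.+-identityʳ (sumℤ f) ⟨
      sumℤ f ℤ.+ + 0       ≡⟨ cong₂ ℤ._+_ {x = sumℤ f} refl gj≡0 ⟨
      -- `f` and `g` differ only at `j`, where `g` is 0 by irreflexivity and `f` is, by unfolding
      -- `μ`, minus the sum of `g`.
      sumℤ f ℤ.+ g j       ≡⟨ sumℤ-update f g j f≡g ⟩
      sumℤ g ℤ.+ f j       ≡⟨ cong₂ ℤ._+_ {x = sumℤ g} refl fj ⟩
      sumℤ g ℤ.- sumℤ g    ≡⟨ ℤ.+-inverseʳ (sumℤ g) ⟩
      + 0                  ∎
      where
      open ≡-Reasoning
      f g : Fin r → ℤ
      f i = if le i j then μ i else + 0
      g   = below j (λ {i} _ → μ i)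

      gj≡0 : g j ≡ + 0
      gj≡0 with j ⊏? j
      ... | yes (_ , j≢j) = contradiction refl j≢j
      ... | no  _         = refl

      fj : f j ≡ ℤ.- sumℤ g
      fj = trans (cong (λ b → if b then μ j else + 0) (le-refl j)) (trans (unfold-wfRec {j}) (step-nonbottom j _ Fj≉⊥))

      f≡g : ∀ i → i ≢ j → f i ≡ g i
      f≡g i i≢j with i ⊏? j
      ... | yes (i≤j , _) = cong (λ b → if b then μ i else + 0) i≤j
      ... | no  ¬i⊏j      = cong (λ b → if b then μ i else + 0) (¬-not λ i≤j → ¬i⊏j (i≤j , i≢j))

  -- Matching equal flats gives a map `σ` between the index sets, bijective because neither
  -- enumeration repeats a flat. It preserves order and dimension, hence `μ` by induction along the
  -- order, so the two coefficient sums agree up to a permutation.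
  charPoly-unique :
    (∀ S {d d′} → HasDim (Flat A S) d → HasDim (Flat A S) d′ → d ≡ d′) →
    ∀ {p p′} → CharPolyData A p → CharPolyData A p′ → ∀ e → p e ≡ p′ e
  charPoly-unique dim-unique {p} {p′} D D′ e = begin
    p e                                                                ≡⟨ D.coeff e ⟩
    sumℤ (λ j → if ⌊ D.dim j ℕ.≟ e ⌋ then D.μ j else + 0)              ≡⟨ sumℤ-cong (λ j → cong₂ (λ d z → if ⌊ d ℕ.≟ e ⌋ then z else + 0) (dim-σ j) (WF.All.wfRec E.⊏-wellFounded 0ℓ _ μ-σ j)) ⟩
    sumℤ (λ j → if ⌊ D′.dim (σ j) ℕ.≟ e ⌋ then D′.μ (σ j) else + 0)    ≡⟨ sumℤ-permute (λ j → if ⌊ D′.dim j ℕ.≟ e ⌋ then D′.μ j else + 0) σ τ στ τσ ⟩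
    sumℤ (λ j → if ⌊ D′.dim j ℕ.≟ e ⌋ then D′.μ j else + 0)            ≡⟨ D′.coeff e ⟨
    p′ e                                                               ∎
    where
    open ≡-Reasoning
    module D  = CharPolyData D
    module D′ = CharPolyData D′
    module E  = Enumeration D.F D.complete D.distinct D.le D.le-spec₁ D.le-spec₂

    σ : Fin D.r → Fin D′.r
    σ i = proj₁ (D′.complete (D.F i))

    τ : Fin D′.r → Fin D.r
    τ j = proj₁ (D.complete (D′.F j))

    F≈σ : ∀ i → D.F i ≈ D′.F (σ i)
    F≈σ i = proj₂ (D′.complete (D.F i))

    F′≈τ : ∀ j → D′.F j ≈ D.F (τ j)
    F′≈τ j = proj₂ (D.complete (D′.F j))

    στ : ∀ j → σ (τ j) ≡ j
    στ j = sym (D′.distinct j (σ (τ j)) (≈-trans {D′.F j} {D.F (τ j)} {D′.F (σ (τ j))} (F′≈τ j) (F≈σ (τ j))))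

    τσ : ∀ i → τ (σ i) ≡ i
    τσ i = sym (D.distinct i (τ (σ i)) (≈-trans {D.F i} {D′.F (σ i)} {D.F (τ (σ i))} (F≈σ i) (F′≈τ (σ i))))

    dim-σ : ∀ i → D.dim i ≡ D′.dim (σ i)
    dim-σ i with (b , b∈ , indep , span) ← D′.dim-spec (σ i) =
      dim-unique (D.F i) (D.dim-spec i)
        (b , (λ j → proj₂ (F≈σ i) _ (b∈ j)) , indep , λ x → span x ∘ proj₁ (F≈σ i) x)

    le-σ : ∀ i j → D.le i j ≡ D′.le (σ i) (σ j)
    le-σ i j = ⇔→≡ (mk⇔
      (λ i≤j → D′.le-spec₂ _ _ λ x → proj₁ (F≈σ i) x ∘ D.le-spec₁ i j i≤j x ∘ proj₂ (F≈σ j) x)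
      (λ i≤j → D.le-spec₂ _ _ λ x → proj₂ (F≈σ i) x ∘ D′.le-spec₁ _ _ i≤j x ∘ proj₁ (F≈σ j) x))

    μ-σ : ∀ j → WfRec E._⊏_ (λ j → D.μ j ≡ D′.μ (σ j)) j → D.μ j ≡ D′.μ (σ j)
    μ-σ j IH with E.bottom? j
    ... | yes Fj≈⊥ = trans (D.μ-bot j Fj≈⊥)
          (sym (D′.μ-bot (σ j) (≈-trans {D′.F (σ j)} {D.F j} {Sub.⊥} (≈-sym {D.F j} {D′.F (σ j)} (F≈σ j)) Fj≈⊥)))
    ... | no  Fj≉⊥ = begin
      D.μ j             ≡⟨ cong (λ b → if b then D.μ j else + 0) (E.le-refl j) ⟨
      f j               ≡⟨ ℤ.+-identityˡ (f j) ⟨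
      -- Both Möbius sums vanish and, by induction, agree term by term away from `j`; so their terms
      -- at `j` agree too.
      + 0 ℤ.+ f j       ≡⟨ cong (ℤ._+ f j) Σg≡0 ⟨
      sumℤ g ℤ.+ f j    ≡⟨ sumℤ-update f g j f≡g ⟨
      sumℤ f ℤ.+ g j    ≡⟨ cong (ℤ._+ g j) (D.μ-rec j Fj≉⊥) ⟩
      + 0 ℤ.+ g j       ≡⟨ ℤ.+-identityˡ (g j) ⟩
      g j               ≡⟨ cong (λ b → if b then D′.μ (σ j) else + 0) (trans (sym (le-σ j j)) (E.le-refl j)) ⟩
      D′.μ (σ j)        ∎
      where
      f g : Fin D.r → ℤ
      f i = if D.le i j then D.μ i else + 0
      g i = if D′.le (σ i) (σ j) then D′.μ (σ i) else + 0

      Σg≡0 : sumℤ g ≡ + 0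
      Σg≡0 = trans (sumℤ-permute (λ i → if D′.le i (σ j) then D′.μ i else + 0) σ τ στ τσ)
        (D′.μ-rec (σ j) λ F′≈⊥ → Fj≉⊥ (≈-trans {D.F j} {D′.F (σ j)} {Sub.⊥} (F≈σ j) F′≈⊥))

      f≡g : ∀ i → i ≢ j → f i ≡ g i
      f≡g i i≢j with D.le i j in eq | D′.le (σ i) (σ j) | le-σ i j
      ... | true  | .true  | refl = IH (eq , i≢j)
      ... | false | .false | refl = refl

  charPoly-exists :
    (∀ S T → Dec (S ⊑ T)) → (∀ S → Σ ℕ (HasDim (Flat A S))) → Σ (ℕ → ℤ) (CharPolyData A)
  -- The coefficient sequence is left to inference: `coeff` fixes it as the defining sum.
  charPoly-exists _⊑?_ dimension = _ , record
    { r        = List.length reps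
    ; F        = F
    ; complete = complete
    ; distinct = distinct
    ; le       = le
    ; le-spec₁ = le-spec₁
    ; le-spec₂ = le-spec₂
    ; μ        = E.μ
    ; μ-bot    = E.μ-bottom
    ; μ-rec    = E.μ-rec
    ; dim      = proj₁ ∘ dimension ∘ F
    ; dim-spec = proj₂ ∘ dimension ∘ F
    ; coeff    = λ e → refl
    }
    where
    flatDecSetoid : DecSetoid 0ℓ 0ℓ
    flatDecSetoid = record
      { Carrier = Subset (size A)
      ; _≈_     = _≈_
      ; isDecEquivalence = record
        { isEquivalence = record
          { refl  = λ {S} → ≈-refl {S}
          ; sym   = λ {S} {T} → ≈-sym {S} {T}
          ; trans = λ {S} {T} {U} → ≈-trans {S} {T} {U}
          }
        ; _≟_ = λ S T → (S ⊑? T) ×-dec (T ⊑? S)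
        }
      }
    open DecSetoid flatDecSetoid using (_≟_)

    reps : List (Subset (size A))
    reps = deduplicate _≟_ (subsets (size A))

    F : Fin (List.length reps) → Subset (size A)
    F = List.lookup reps

    complete : ∀ S → Σ (Fin (List.length reps)) λ j → S ≈ F j
    complete S = Any.index S∈reps , Any.lookup-index S∈reps
      where
      S∈reps : Any (S ≈_) reps
      S∈reps = Any.deduplicate⁺ _≟_ (λ {T} {U} T≈U S≈T → ≈-trans {S} {T} {U} S≈T (≈-sym {U} {T} T≈U))
                 (Any.map (λ { refl → ≈-refl {S} }) (∈-subsets S))

    distinct : ∀ i j → F i ≈ F j → i ≡ j
    distinct i j Fi≈Fj with i Fin.≟ j
    ... | yes i≡j = i≡j
    ... | no  i≢j = contradiction Fi≈Fj
      (AllPairs-lookup (λ {S} {T} S≉T T≈S → S≉T (≈-sym {T} {S} T≈S)) (DecUnique.deduplicate-! flatDecSetoid (subsets (size A))) i j i≢j)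

    le : Fin (List.length reps) → Fin (List.length reps) → Bool
    le i j = ⌊ F j ⊑? F i ⌋

    le-spec₁ : ∀ i j → le i j ≡ true → F j ⊑ F i
    le-spec₁ i j with F j ⊑? F i
    ... | yes Fj⊑Fi = λ _ → Fj⊑Fi
    ... | no  _     = λ ()

    le-spec₂ : ∀ i j → F j ⊑ F i → le i j ≡ true
    le-spec₂ i j Fj⊑Fi with F j ⊑? F i
    ... | yes _     = refl
    ... | no  Fj⋢Fi = contradiction Fj⊑Fi Fj⋢Fi

    module E = Enumeration F complete distinct le le-spec₁ le-spec₂

-- Dimension over ℚ

sumℚ≡ : ∀ {k} (f : Fin k → ℚ) → sumℚ f ≡ Σℚ.sum f
sumℚ≡ {zero}  f = refl
sumℚ≡ {suc k} f = cong (f Fin.zero ℚ.+_) (sumℚ≡ (f ∘ Fin.suc))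

sumℚ-cong : ∀ {k} {f g : Fin k → ℚ} → (∀ i → f i ≡ g i) → sumℚ f ≡ sumℚ g
sumℚ-cong {zero}  eq = refl
sumℚ-cong {suc k} eq = cong₂ ℚ._+_ (eq Fin.zero) (sumℚ-cong (eq ∘ Fin.suc))

sumℚ-zero : ∀ {k} {f : Fin k → ℚ} → (∀ i → f i ≡ 0ℚ) → sumℚ f ≡ 0ℚ
sumℚ-zero {zero}  f≡0 = refl
sumℚ-zero {suc k} f≡0 = cong₂ ℚ._+_ (f≡0 Fin.zero) (sumℚ-zero (f≡0 ∘ Fin.suc))

sumℚ-+ : ∀ {k} (f g : Fin k → ℚ) → sumℚ (λ i → f i ℚ.+ g i) ≡ sumℚ f ℚ.+ sumℚ g
sumℚ-+ f g = begin
  sumℚ (λ i → f i ℚ.+ g i)   ≡⟨ sumℚ≡ (λ i → f i ℚ.+ g i) ⟩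
  Σℚ.sum (λ i → f i ℚ.+ g i) ≡⟨ Σℚ.∑-distrib-+ f g ⟩
  Σℚ.sum f ℚ.+ Σℚ.sum g      ≡⟨ cong₂ ℚ._+_ (sumℚ≡ f) (sumℚ≡ g) ⟨
  sumℚ f ℚ.+ sumℚ g          ∎
  where open ≡-Reasoning

sumℚ-*ʳ : ∀ {k} (f : Fin k → ℚ) c → sumℚ f ℚ.* c ≡ sumℚ (λ i → f i ℚ.* c)
sumℚ-*ʳ f c = begin
  sumℚ f ℚ.* c             ≡⟨ cong (ℚ._* c) (sumℚ≡ f) ⟩
  Σℚ.sum f ℚ.* c           ≡⟨ Σℚ.*-distribʳ-sum c f ⟩
  Σℚ.sum (λ i → f i ℚ.* c) ≡⟨ sumℚ≡ (λ i → f i ℚ.* c) ⟨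
  sumℚ (λ i → f i ℚ.* c)   ∎
  where open ≡-Reasoning

sumℚ-*ˡ : ∀ {k} (f : Fin k → ℚ) c → c ℚ.* sumℚ f ≡ sumℚ (λ i → c ℚ.* f i)
sumℚ-*ˡ f c = begin
  c ℚ.* sumℚ f           ≡⟨ ℚ.*-comm c (sumℚ f) ⟩
  sumℚ f ℚ.* c           ≡⟨ sumℚ-*ʳ f c ⟩
  sumℚ (λ i → f i ℚ.* c) ≡⟨ sumℚ-cong (λ i → ℚ.*-comm (f i) c) ⟩
  sumℚ (λ i → c ℚ.* f i) ∎
  where open ≡-Reasoning

sumℚ-swap : ∀ {k l} (f : Fin k → Fin l → ℚ) →
  sumℚ (λ i → sumℚ (f i)) ≡ sumℚ (λ j → sumℚ (λ i → f i j))
sumℚ-swap f = begin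
  sumℚ (λ i → sumℚ (f i))               ≡⟨ sumℚ-cong (λ i → sumℚ≡ (f i)) ⟩
  sumℚ (λ i → Σℚ.sum (f i))             ≡⟨ sumℚ≡ (λ i → Σℚ.sum (f i)) ⟩
  Σℚ.sum (λ i → Σℚ.sum (f i))           ≡⟨ Σℚ.∑-comm f ⟩
  Σℚ.sum (λ j → Σℚ.sum (λ i → f i j))   ≡⟨ sumℚ≡ (λ j → Σℚ.sum (λ i → f i j)) ⟨
  sumℚ (λ j → Σℚ.sum (λ i → f i j))     ≡⟨ sumℚ-cong (λ j → sumℚ≡ (λ i → f i j)) ⟨
  sumℚ (λ j → sumℚ (λ i → f i j))       ∎
  where open ≡-Reasoning

sumℚ-remove : ∀ {k} (f : Fin (suc k) → ℚ) p → sumℚ f ≡ f p ℚ.+ sumℚ (f ∘ punchIn p)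
sumℚ-remove f p = begin
  sumℚ f                            ≡⟨ sumℚ≡ f ⟩
  Σℚ.sum f                          ≡⟨ Σℚ.sum-remove {i = p} f ⟩
  f p ℚ.+ Σℚ.sum (f ∘ punchIn p)    ≡⟨ cong (f p ℚ.+_) (sumℚ≡ (f ∘ punchIn p)) ⟨
  f p ℚ.+ sumℚ (f ∘ punchIn p)      ∎
  where open ≡-Reasoning

sumℚ-single : ∀ {k} (f : Fin k → ℚ) p → (∀ i → i ≢ p → f i ≡ 0ℚ) → sumℚ f ≡ f p
sumℚ-single {suc k} f p f≡0 = begin
  sumℚ f                         ≡⟨ sumℚ-remove f p ⟩
  f p ℚ.+ sumℚ (f ∘ punchIn p)   ≡⟨ cong (f p ℚ.+_) (sumℚ-zero λ i → f≡0 (punchIn p i) (punchInᵢ≢i p i)) ⟩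
  f p ℚ.+ 0ℚ                     ≡⟨ ℚ.+-identityʳ (f p) ⟩
  f p                            ∎
  where open ≡-Reasoning

*-cancel-0 : ∀ {c x} → c ≢ 0ℚ → c ℚ.* x ≡ 0ℚ → x ≡ 0ℚ
*-cancel-0 {c} {x} c≢0 cx≡0 = begin
  x                  ≡⟨ ℚ.*-identityˡ x ⟨
  1ℚ ℚ.* x           ≡⟨ cong (ℚ._* x) (ℚ.*-inverseˡ c) ⟨
  c⁻¹ ℚ.* c ℚ.* x    ≡⟨ ℚ.*-assoc c⁻¹ c x ⟩
  c⁻¹ ℚ.* (c ℚ.* x)  ≡⟨ cong (c⁻¹ ℚ.*_) cx≡0 ⟩
  c⁻¹ ℚ.* 0ℚ         ≡⟨ ℚ.*-zeroʳ c⁻¹ ⟩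
  0ℚ                 ∎
  where
  open ≡-Reasoning
  instance
    c-nonZero : ℚ.NonZero c
    c-nonZero = ℚ.≢-nonZero c≢0
  c⁻¹ : ℚ
  c⁻¹ = ℚ.1/ c

Independent : ∀ {d k} → (Fin d → Point k) → Set
Independent b = ∀ λs → (∀ i → lincomb λs b i ≡ 0ℚ) → ∀ j → λs j ≡ 0ℚ

-- Gaussian elimination on coordinate 0. If that column vanishes it is dropped; otherwise a vector
-- with a nonzero entry `c` there clears the others and is removed along with the coordinate.
independent⇒≤ : ∀ {d k} (b : Fin d → Point k) → Independent b → d ≤ k
independent⇒≤ {zero}          b indep = z≤n
independent⇒≤ {suc d} {zero}  b indep = contradiction (indep (λ _ → 1ℚ) (λ ()) Fin.zero) λ ()
independent⇒≤ {suc d} {suc k} b indep with any? (λ j → ¬? (b j Fin.zero ℚ.≟ 0ℚ))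
... | no  none = ℕ.m≤n⇒m≤1+n (independent⇒≤ (λ j → b j ∘ Fin.suc) λ λs eq → indep λs λ where
    Fin.zero    → sumℚ-zero λ j → trans (cong (λs j ℚ.*_) (column₀≡0 j)) (ℚ.*-zeroʳ (λs j))
    (Fin.suc i) → eq i)
  where
  column₀≡0 : ∀ j → b j Fin.zero ≡ 0ℚ
  column₀≡0 j = decidable-stable (b j Fin.zero ℚ.≟ 0ℚ) λ bj≢0 → none (j , bj≢0)
... | yes (p , c≢0) = s≤s (independent⇒≤ (λ l → eliminated l ∘ Fin.suc) eliminated-independent)
  where
  open ≡-Reasoning
  c : ℚ
  c = b p Fin.zero

  -- Cross-multiplied rather than divided by the pivot, so that coordinate 0 cancels by a polynomial
  -- identity.
  eliminated : Fin d → Point (suc k)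
  eliminated l i = c ℚ.* b (punchIn p l) i ℚ.- b (punchIn p l) Fin.zero ℚ.* b p i

  module _ (λs : Fin d → ℚ) where
    s : ℚ
    s = sumℚ (λ l → λs l ℚ.* b (punchIn p l) Fin.zero)

    -- Coefficients of the same combination in terms of the original vectors; the entry at `p`
    -- collects what elimination subtracts.
    lifted : Fin (suc d) → ℚ
    lifted = insertAt (λ l → c ℚ.* λs l) p (ℚ.- s)

    lincomb-lifted : ∀ i → lincomb lifted b i ≡ lincomb λs eliminated i
    lincomb-lifted i = begin
      lincomb lifted b i
        ≡⟨ sumℚ-remove (λ j → lifted j ℚ.* b j i) p ⟩
      lifted p ℚ.* b p i ℚ.+ sumℚ (λ l → lifted (punchIn p l) ℚ.* b (punchIn p l) i)
        ≡⟨ cong₂ (λ x y → x ℚ.* b p i ℚ.+ y) (insertAt-lookup (λ l → c ℚ.* λs l) p (ℚ.- s))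
             (sumℚ-cong λ l → cong (ℚ._* b (punchIn p l) i) (insertAt-punchIn (λ l → c ℚ.* λs l) p (ℚ.- s) l)) ⟩
      ℚ.- s ℚ.* b p i ℚ.+ sumℚ (λ l → c ℚ.* λs l ℚ.* b (punchIn p l) i)
        ≡⟨ cong₂ ℚ._+_ (solve 2 (λ x y → :- x :* y := x :* :- y) refl s (b p i)) refl ⟩
      s ℚ.* ℚ.- b p i ℚ.+ sumℚ (λ l → c ℚ.* λs l ℚ.* b (punchIn p l) i)
        ≡⟨ cong₂ ℚ._+_ (sumℚ-*ʳ (λ l → λs l ℚ.* b (punchIn p l) Fin.zero) (ℚ.- b p i)) refl ⟩
      sumℚ (λ l → λs l ℚ.* b (punchIn p l) Fin.zero ℚ.* ℚ.- b p i) ℚ.+ sumℚ (λ l → c ℚ.* λs l ℚ.* b (punchIn p l) i)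
        ≡⟨ sumℚ-+ (λ l → λs l ℚ.* b (punchIn p l) Fin.zero ℚ.* ℚ.- b p i) (λ l → c ℚ.* λs l ℚ.* b (punchIn p l) i) ⟨
      sumℚ (λ l → λs l ℚ.* b (punchIn p l) Fin.zero ℚ.* ℚ.- b p i ℚ.+ c ℚ.* λs l ℚ.* b (punchIn p l) i)
        ≡⟨ sumℚ-cong (λ l → solve 5 (λ x y z w c → x :* y :* :- z :+ c :* x :* w := x :* (c :* w :- y :* z)) refl
             (λs l) (b (punchIn p l) Fin.zero) (b p i) (b (punchIn p l) i) c) ⟩
      lincomb λs eliminated i
        ∎
      where open ℚ-Solver

    eliminated₀≡0 : ∀ l → λs l ℚ.* eliminated l Fin.zero ≡ 0ℚ
    eliminated₀≡0 l = solve 3 (λ x c y → x :* (c :* y :- y :* c) := con 0ℚ) refl (λs l) c (b (punchIn p l) Fin.zero)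
      where open ℚ-Solver

  eliminated-independent : Independent (λ l → eliminated l ∘ Fin.suc)
  eliminated-independent λs eq l = *-cancel-0 c≢0 (trans
    (sym (insertAt-punchIn (λ l → c ℚ.* λs l) p (ℚ.- s λs) l))
    (indep (lifted λs) (λ i → trans (lincomb-lifted λs i) (vanishes i)) (punchIn p l)))
    where
    vanishes : ∀ i → lincomb λs eliminated i ≡ 0ℚ
    vanishes Fin.zero    = sumℚ-zero (eliminated₀≡0 λs)
    vanishes (Fin.suc i) = eq i

-- A relation among the coordinate vectors of the `b j` with respect to `b′` is also a relation
-- among the `b j`; so these `d` vectors of length `d′` are independent.
dim-mono : ∀ {n} {P : Point n → Set} {d d′} → HasDim P d → HasDim P d′ → d ≤ d′
dim-mono (b , b∈ , indep , _) (b′ , _ , _ , span) =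
  independent⇒≤ coords λ λs eq → indep λs λ i → begin
    sumℚ (λ j → λs j ℚ.* b j i)
      ≡⟨ sumℚ-cong (λ j → trans (cong (λs j ℚ.*_) (proj₂ (span (b j) (b∈ j)) i)) (sumℚ-*ˡ (λ l → coords j l ℚ.* b′ l i) (λs j))) ⟩
    sumℚ (λ j → sumℚ (λ l → λs j ℚ.* (coords j l ℚ.* b′ l i)))
      ≡⟨ sumℚ-swap (λ j l → λs j ℚ.* (coords j l ℚ.* b′ l i)) ⟩
    sumℚ (λ l → sumℚ (λ j → λs j ℚ.* (coords j l ℚ.* b′ l i)))
      ≡⟨ sumℚ-zero (λ l → begin
           sumℚ (λ j → λs j ℚ.* (coords j l ℚ.* b′ l i))   ≡⟨ sumℚ-cong (λ j → ℚ.*-assoc (λs j) (coords j l) (b′ l i)) ⟨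
           sumℚ (λ j → λs j ℚ.* coords j l ℚ.* b′ l i)     ≡⟨ sumℚ-*ʳ (λ j → λs j ℚ.* coords j l) (b′ l i) ⟨
           sumℚ (λ j → λs j ℚ.* coords j l) ℚ.* b′ l i     ≡⟨ cong (ℚ._* b′ l i) (eq l) ⟩
           0ℚ ℚ.* b′ l i                                   ≡⟨ ℚ.*-zeroˡ (b′ l i) ⟩
           0ℚ                                              ∎) ⟩
    0ℚ ∎
  where
  open ≡-Reasoning
  coords = λ j → proj₁ (span (b j) (b∈ j))

dim-unique : ∀ {n} {P : Point n → Set} {d d′} → HasDim P d → HasDim P d′ → d ≡ d′
dim-unique D D′ = ℕ.≤-antisym (dim-mono D D′) (dim-mono D′ D)

-- Monomials a^g

fromℚᵘ-+ : ∀ p q → fromℚᵘ (p ℚᵘ.+ q) ≡ fromℚᵘ p ℚ.+ fromℚᵘ q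
fromℚᵘ-+ p q = ℚ.toℚᵘ-injective (begin
  toℚᵘ (fromℚᵘ (p ℚᵘ.+ q))                ≈⟨ ℚ.toℚᵘ-fromℚᵘ (p ℚᵘ.+ q) ⟩
  p ℚᵘ.+ q                                ≈⟨ ℚᵘ.+-cong (ℚ.toℚᵘ-fromℚᵘ p) (ℚ.toℚᵘ-fromℚᵘ q) ⟨
  toℚᵘ (fromℚᵘ p) ℚᵘ.+ toℚᵘ (fromℚᵘ q)    ≈⟨ ℚ.toℚᵘ-homo-+ (fromℚᵘ p) (fromℚᵘ q) ⟨
  toℚᵘ (fromℚᵘ p ℚ.+ fromℚᵘ q)            ∎)
  where open import Relation.Binary.Reasoning.Setoid ℚᵘ.≃-setoid

fromℚᵘ-* : ∀ p q → fromℚᵘ (p ℚᵘ.* q) ≡ fromℚᵘ p ℚ.* fromℚᵘ q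
fromℚᵘ-* p q = ℚ.toℚᵘ-injective (begin
  toℚᵘ (fromℚᵘ (p ℚᵘ.* q))                ≈⟨ ℚ.toℚᵘ-fromℚᵘ (p ℚᵘ.* q) ⟩
  p ℚᵘ.* q                                ≈⟨ ℚᵘ.*-cong (ℚ.toℚᵘ-fromℚᵘ p) (ℚ.toℚᵘ-fromℚᵘ q) ⟨
  toℚᵘ (fromℚᵘ p) ℚᵘ.* toℚᵘ (fromℚᵘ q)    ≈⟨ ℚ.toℚᵘ-homo-* (fromℚᵘ p) (fromℚᵘ q) ⟨
  toℚᵘ (fromℚᵘ p ℚ.* fromℚᵘ q)            ∎)
  where open import Relation.Binary.Reasoning.Setoid ℚᵘ.≃-setoid

-- `z / 1` is by definition `fromℚᵘ` of an unnormalised fraction, where addition is a plain formula;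
-- the identity is checked there, before any common factor is cancelled.
ℤ→ℚ-+ : ∀ x y → ℤ→ℚ (x ℤ.+ y) ≡ ℤ→ℚ x ℚ.+ ℤ→ℚ y
ℤ→ℚ-+ x y = trans
  (ℚ.fromℚᵘ-cong {mkℚᵘ (x ℤ.+ y) 0} {mkℚᵘ x 0 ℚᵘ.+ mkℚᵘ y 0}
    (*≡* (solve 2 (λ x y → (x :+ y) :* con (+ 1) := (x :* con (+ 1) :+ y :* con (+ 1)) :* con (+ 1)) refl x y)))
  (fromℚᵘ-+ (mkℚᵘ x 0) (mkℚᵘ y 0))
  where open ℤ-Solver

ℤ→ℚ-* : ∀ x y → ℤ→ℚ (x ℤ.* y) ≡ ℤ→ℚ x ℚ.* ℤ→ℚ y
ℤ→ℚ-* x y = fromℚᵘ-* (mkℚᵘ x 0) (mkℚᵘ y 0)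

ℤ→ℚ-neg : ∀ x → ℤ→ℚ (ℤ.- x) ≡ ℚ.- ℤ→ℚ x
ℤ→ℚ-neg (+ zero)   = refl
ℤ→ℚ-neg (+ suc k)  = refl
ℤ→ℚ-neg (-[1+ k ]) = solve 1 (λ x → x := :- :- x) refl (ℤ→ℚ (+ suc k))
  where open ℚ-Solver

ℕ→ℚ-* : ∀ j k → ℕ→ℚ (j ℕ.* k) ≡ ℕ→ℚ j ℚ.* ℕ→ℚ k
ℕ→ℚ-* j k = trans (cong ℤ→ℚ (ℤ.pos-* j k)) (ℤ→ℚ-* (+ j) (+ k))

ℕ→ℚ*recipℕ : ∀ k → k ≢ 0 → ℕ→ℚ k ℚ.* recipℕ k ≡ 1ℚ
ℕ→ℚ*recipℕ zero    k≢0 = contradiction refl k≢0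
ℕ→ℚ*recipℕ (suc k) _   = trans (sym (fromℚᵘ-* (mkℚᵘ (+ suc k) 0) (mkℚᵘ (+ 1) k)))
  (ℚ.fromℚᵘ-cong {mkℚᵘ (+ suc k) 0 ℚᵘ.* mkℚᵘ (+ 1) k} {mkℚᵘ (+ 1) 0}
    (*≡* (trans (solve 1 (λ x → x :* con (+ 1) :* con (+ 1) := con (+ 1) :* x) refl (+ suc k))
      (cong (λ d → + 1 ℤ.* + suc d) (sym (ℕ.+-identityʳ k))))))
  where open ℤ-Solver

ℕ→ℚ≢0 : ∀ {k} → k ≢ 0 → ℕ→ℚ k ≢ 0ℚ
ℕ→ℚ≢0 {k} k≢0 eq = contradiction (begin
  1ℚ                     ≡⟨ ℕ→ℚ*recipℕ k k≢0 ⟨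
  ℕ→ℚ k ℚ.* recipℕ k     ≡⟨ cong (ℚ._* recipℕ k) eq ⟩
  0ℚ ℚ.* recipℕ k        ≡⟨ ℚ.*-zeroˡ (recipℕ k) ⟩
  0ℚ                     ∎) λ ()
  where open ≡-Reasoning

*-cancelˡ : ∀ {c x y} → c ≢ 0ℚ → c ℚ.* x ≡ c ℚ.* y → x ≡ y
*-cancelˡ {c} {x} {y} c≢0 eq = begin
  x                   ≡⟨ solve 2 (λ x y → x := (x :- y) :+ y) refl x y ⟩
  x ℚ.- y ℚ.+ y       ≡⟨ cong (ℚ._+ y) (*-cancel-0 c≢0 c[x-y]≡0) ⟩
  0ℚ ℚ.+ y            ≡⟨ ℚ.+-identityˡ y ⟩
  y                   ∎
  where
  open ≡-Reasoning
  open ℚ-Solver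
  c[x-y]≡0 : c ℚ.* (x ℚ.- y) ≡ 0ℚ
  c[x-y]≡0 = begin
    c ℚ.* (x ℚ.- y)           ≡⟨ solve 3 (λ c x y → c :* (x :- y) := c :* x :- c :* y) refl c x y ⟩
    c ℚ.* x ℚ.- c ℚ.* y       ≡⟨ cong (ℚ._- c ℚ.* y) eq ⟩
    c ℚ.* y ℚ.- c ℚ.* y       ≡⟨ ℚ.+-inverseʳ (c ℚ.* y) ⟩
    0ℚ                        ∎

module _ {a : ℕ} (a≢0 : a ≢ 0) where

  ^≢0 : ∀ k → a ℕ.^ k ≢ 0
  ^≢0 k eq = a≢0 (ℕ.m^n≡0⇒m≡0 a k eq)

  zpow-suc : ∀ z → zpow a (+ 1 ℤ.+ z) ≡ ℕ→ℚ a ℚ.* zpow a z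
  zpow-suc (+ k)         = ℕ→ℚ-* a (a ℕ.^ k)
  zpow-suc -[1+ zero ]   = begin
    1ℚ                          ≡⟨ ℕ→ℚ*recipℕ (a ℕ.^ 1) (^≢0 1) ⟨
    ℕ→ℚ (a ℕ.^ 1) ℚ.* recipℕ (a ℕ.^ 1) ≡⟨ cong (λ b → ℕ→ℚ b ℚ.* recipℕ (a ℕ.^ 1)) (ℕ.*-identityʳ a) ⟩
    ℕ→ℚ a ℚ.* recipℕ (a ℕ.^ 1)  ∎
    where open ≡-Reasoning
  -- Both sides become 1 after multiplication by a^(k+1).
  zpow-suc -[1+ suc k ]  = *-cancelˡ (ℕ→ℚ≢0 (^≢0 (suc k))) (begin
    ℕ→ℚ (a ℕ.^ suc k) ℚ.* recipℕ (a ℕ.^ suc k)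
      ≡⟨ ℕ→ℚ*recipℕ (a ℕ.^ suc k) (^≢0 (suc k)) ⟩
    1ℚ
      ≡⟨ ℕ→ℚ*recipℕ (a ℕ.^ suc (suc k)) (^≢0 (suc (suc k))) ⟨
    ℕ→ℚ (a ℕ.^ suc (suc k)) ℚ.* recipℕ (a ℕ.^ suc (suc k))
      ≡⟨ cong (ℚ._* recipℕ (a ℕ.^ suc (suc k))) (ℕ→ℚ-* a (a ℕ.^ suc k)) ⟩
    ℕ→ℚ a ℚ.* ℕ→ℚ (a ℕ.^ suc k) ℚ.* recipℕ (a ℕ.^ suc (suc k))
      ≡⟨ solve 3 (λ x y z → x :* y :* z := y :* (x :* z)) refl (ℕ→ℚ a) (ℕ→ℚ (a ℕ.^ suc k)) (recipℕ (a ℕ.^ suc (suc k))) ⟩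
    ℕ→ℚ (a ℕ.^ suc k) ℚ.* (ℕ→ℚ a ℚ.* recipℕ (a ℕ.^ suc (suc k)))
      ∎)
    where
    open ≡-Reasoning
    open ℚ-Solver

  zpow-+ : ∀ x y → zpow a (x ℤ.+ y) ≡ zpow a x ℚ.* zpow a y
  zpow-+ (+ zero)  y = trans (cong (zpow a) (ℤ.+-identityˡ y)) (sym (ℚ.*-identityˡ (zpow a y)))
  zpow-+ (+ suc k) y = begin
    zpow a (+ suc k ℤ.+ y)              ≡⟨ cong (zpow a) (ℤ.+-assoc (+ 1) (+ k) y) ⟩
    zpow a (+ 1 ℤ.+ (+ k ℤ.+ y))        ≡⟨ zpow-suc (+ k ℤ.+ y) ⟩
    ℕ→ℚ a ℚ.* zpow a (+ k ℤ.+ y)        ≡⟨ cong (ℕ→ℚ a ℚ.*_) (zpow-+ (+ k) y) ⟩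
    ℕ→ℚ a ℚ.* (zpow a (+ k) ℚ.* zpow a y) ≡⟨ ℚ.*-assoc (ℕ→ℚ a) (zpow a (+ k)) (zpow a y) ⟨
    ℕ→ℚ a ℚ.* zpow a (+ k) ℚ.* zpow a y ≡⟨ cong (ℚ._* zpow a y) (zpow-suc (+ k)) ⟨
    zpow a (+ suc k) ℚ.* zpow a y       ∎
    where open ≡-Reasoning
  -- Multiplying both sides by `a` moves the negative exponent one step towards 0, where induction
  -- applies.
  zpow-+ -[1+ k ]  y = *-cancelˡ (ℕ→ℚ≢0 a≢0) (begin
    ℕ→ℚ a ℚ.* zpow a (-[1+ k ] ℤ.+ y)          ≡⟨ zpow-suc (-[1+ k ] ℤ.+ y) ⟨
    zpow a (+ 1 ℤ.+ (-[1+ k ] ℤ.+ y))          ≡⟨ cong (zpow a) (ℤ.+-assoc (+ 1) -[1+ k ] y) ⟨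
    zpow a (+ 1 ℤ.+ -[1+ k ] ℤ.+ y)            ≡⟨ shifted k ⟩
    zpow a (+ 1 ℤ.+ -[1+ k ]) ℚ.* zpow a y     ≡⟨ cong (ℚ._* zpow a y) (zpow-suc -[1+ k ]) ⟩
    ℕ→ℚ a ℚ.* zpow a -[1+ k ] ℚ.* zpow a y     ≡⟨ ℚ.*-assoc (ℕ→ℚ a) (zpow a -[1+ k ]) (zpow a y) ⟩
    ℕ→ℚ a ℚ.* (zpow a -[1+ k ] ℚ.* zpow a y)   ∎)
    where
    open ≡-Reasoning
    -- The exponent 1 - (1+k) computes only once `k` is split.
    shifted : ∀ k → zpow a (+ 1 ℤ.+ -[1+ k ] ℤ.+ y) ≡ zpow a (+ 1 ℤ.+ -[1+ k ]) ℚ.* zpow a y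
    shifted zero    = zpow-+ (+ 0) y
    shifted (suc k) = zpow-+ -[1+ k ] y

-- Vectors rather than functions `Fin m → ℤ`, so that propositional equality of exponents, and hence
-- of terms, is decidable.
Exponent : ℕ → Set
Exponent m = Vec ℤ m

infixl 6 _⊕_
_⊕_ : ∀ {m} → Exponent m → Exponent m → Exponent m
_⊕_ = zipWith ℤ._+_

⊖_ : ∀ {m} → Exponent m → Exponent m
⊖_ = Vec.map (λ z → ℤ.- z)

𝟘 : ∀ {m} → Exponent m
𝟘 = replicate _ (+ 0)

basis : ∀ {m} → Fin m → Exponent m
basis l = 𝟘 [ l ]≔ + 1

monomial : ∀ {m} → (Fin m → ℕ) → Exponent m → ℚ
monomial a g = prodℚ (λ l → zpow (a l) (lookup g l))

⊖-inverseˡ : ∀ {m} (g : Exponent m) → ⊖ g ⊕ g ≡ 𝟘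
⊖-inverseˡ []      = refl
⊖-inverseˡ (z ∷ g) = cong₂ _∷_ (ℤ.+-inverseˡ z) (⊖-inverseˡ g)

monomial-𝟘 : ∀ {m} (a : Fin m → ℕ) → monomial a 𝟘 ≡ 1ℚ
monomial-𝟘 {zero}  a = refl
monomial-𝟘 {suc m} a = trans (ℚ.*-identityˡ _) (monomial-𝟘 (a ∘ Fin.suc))

monomial-basis : ∀ {m} (a : Fin m → ℕ) l → monomial a (basis l) ≡ ℕ→ℚ (a l)
monomial-basis {suc m} a Fin.zero    = trans
  (cong₂ ℚ._*_ (cong ℕ→ℚ (ℕ.*-identityʳ (a Fin.zero))) (monomial-𝟘 (a ∘ Fin.suc)))
  (ℚ.*-identityʳ (ℕ→ℚ (a Fin.zero)))
monomial-basis {suc m} a (Fin.suc l) = trans (ℚ.*-identityˡ _) (monomial-basis (a ∘ Fin.suc) l)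

monomial-⊕ : ∀ {m} {a : Fin m → ℕ} → (∀ l → a l ≢ 0) → ∀ g h →
  monomial a (g ⊕ h) ≡ monomial a g ℚ.* monomial a h
monomial-⊕ a≢0 []      []      = refl
monomial-⊕ {a = a} a≢0 (x ∷ g) (y ∷ h) = begin
  zpow a₀ (x ℤ.+ y) ℚ.* M (g ⊕ h)
    ≡⟨ cong₂ ℚ._*_ (zpow-+ (a≢0 Fin.zero) x y) (monomial-⊕ (a≢0 ∘ Fin.suc) g h) ⟩
  zpow a₀ x ℚ.* zpow a₀ y ℚ.* (M g ℚ.* M h)
    ≡⟨ solve 4 (λ p q r s → p :* q :* (r :* s) := p :* r :* (q :* s)) refl (zpow a₀ x) (zpow a₀ y) (M g) (M h) ⟩
  zpow a₀ x ℚ.* M g ℚ.* (zpow a₀ y ℚ.* M h)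
    ∎
  where
  open ≡-Reasoning
  open ℚ-Solver
  a₀ = a Fin.zero
  M = monomial (a ∘ Fin.suc)

module _ {m} {a : Fin m → ℕ} (a≢0 : ∀ l → a l ≢ 0) where

  monomial-⊖ : ∀ g → monomial a (⊖ g) ℚ.* monomial a g ≡ 1ℚ
  monomial-⊖ g = begin
    monomial a (⊖ g) ℚ.* monomial a g   ≡⟨ monomial-⊕ a≢0 (⊖ g) g ⟨
    monomial a (⊖ g ⊕ g)                ≡⟨ cong (monomial a) (⊖-inverseˡ g) ⟩
    monomial a 𝟘                        ≡⟨ monomial-𝟘 a ⟩
    1ℚ                                  ∎
    where open ≡-Reasoning

  monomial≢0 : ∀ g → monomial a g ≢ 0ℚ
  monomial≢0 g eq = contradiction (begin
    1ℚ                                  ≡⟨ monomial-⊖ g ⟨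
    monomial a (⊖ g) ℚ.* monomial a g   ≡⟨ cong (monomial a (⊖ g) ℚ.*_) eq ⟩
    monomial a (⊖ g) ℚ.* 0ℚ             ≡⟨ ℚ.*-zeroʳ (monomial a (⊖ g)) ⟩
    0ℚ                                  ∎) λ ()
    where open ≡-Reasoning

  -- Independence speaks of monomials equal to 1, so it is applied to the quotient, with exponent
  -- `⊖ h ⊕ g`.
  monomial-injective : MultIndep a → ∀ g h → monomial a g ≡ monomial a h → g ≡ h
  monomial-injective indep g h eq = begin
    g                       ≡⟨ Vec.tabulate∘lookup g ⟨
    Vec.tabulate (lookup g) ≡⟨ Vec.tabulate-cong lookup-eq ⟩
    Vec.tabulate (lookup h) ≡⟨ Vec.tabulate∘lookup h ⟩
    h                       ∎
    where
    open ≡-Reasoning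
    ratio≡1 : monomial a (⊖ h ⊕ g) ≡ 1ℚ
    ratio≡1 = begin
      monomial a (⊖ h ⊕ g)                ≡⟨ monomial-⊕ a≢0 (⊖ h) g ⟩
      monomial a (⊖ h) ℚ.* monomial a g   ≡⟨ cong (monomial a (⊖ h) ℚ.*_) eq ⟩
      monomial a (⊖ h) ℚ.* monomial a h   ≡⟨ monomial-⊖ h ⟩
      1ℚ                                  ∎

    lookup-eq : ∀ l → lookup g l ≡ lookup h l
    lookup-eq l = begin
      lookup g l                                        ≡⟨ solve 2 (λ x y → x := y :+ (:- y :+ x)) refl (lookup g l) (lookup h l) ⟩
      lookup h l ℤ.+ (ℤ.- lookup h l ℤ.+ lookup g l)    ≡⟨ cong (λ z → lookup h l ℤ.+ (z ℤ.+ lookup g l)) (Vec.lookup-map l (λ z → ℤ.- z) h) ⟨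
      lookup h l ℤ.+ (lookup (⊖ h) l ℤ.+ lookup g l)    ≡⟨ cong₂ ℤ._+_ {x = lookup h l} refl (Vec.lookup-zipWith ℤ._+_ l (⊖ h) g) ⟨
      lookup h l ℤ.+ lookup (⊖ h ⊕ g) l                 ≡⟨ cong₂ ℤ._+_ {x = lookup h l} refl (indep (lookup (⊖ h ⊕ g)) ratio≡1 l) ⟩
      lookup h l ℤ.+ + 0                                ≡⟨ ℤ.+-identityʳ (lookup h l) ⟩
      lookup h l                                        ∎
      where open ℤ-Solver

-- Unification of terms

-- nothing stands for 0 and just (i , g) for a^g xᵢ.
Term : ℕ → ℕ → Set
Term n m = Maybe (Fin n × Exponent m)

Substitution : ℕ → ℕ → Set
Substitution n m = Fin n → Term n m

Equation : ℕ → ℕ → Set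
Equation n m = Term n m × Term n m

infix 4 _≟ᵉ_
_≟ᵉ_ : ∀ {m} → DecidableEquality (Exponent m)
_≟ᵉ_ = Vec.≡-dec ℤ._≟_

module _ {n m : ℕ} where

  infix 4 _≟ᵗ_
  _≟ᵗ_ : DecidableEquality (Term n m)
  _≟ᵗ_ = Maybe.≡-dec (Product.≡-dec Fin._≟_ _≟ᵉ_)

  var : Fin n → Term n m
  var i = just (i , 𝟘)

  scale : Exponent m → Term n m → Term n m
  scale g nothing        = nothing
  scale g (just (i , h)) = just (i , g ⊕ h)

  bind : Term n m → Substitution n m → Term n m
  bind nothing        σ = nothing
  bind (just (i , g)) σ = scale g (σ i)

  infixl 5 _⨾_
  _⨾_ : Substitution n m → Substitution n m → Substitution n m
  (σ ⨾ τ) i = bind (σ i) τ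

  [_:=_] : Fin n → Term n m → Substitution n m
  [ r := t ] i = if ⌊ i Fin.≟ r ⌋ then t else var i

  -- Never fails and needs no occurs check: a term has at most one variable, and every variable may
  -- take the value 0.
  mgu : Term n m → Term n m → Substitution n m
  mgu nothing         nothing         = var
  mgu nothing         (just (r , _))  = [ r := nothing ]
  mgu (just (r , _))  nothing         = [ r := nothing ]
  mgu (just (r , g))  (just (r′ , h)) with r Fin.≟ r′ | g ≟ᵉ h
  ... | no  _ | _     = [ r := just (r′ , ⊖ g ⊕ h) ]
  ... | yes _ | yes _ = var
  ... | yes _ | no  _ = [ r := nothing ]

  solution : ∀ {k} → (Fin k → Equation n m) → Subset k → Substitution n m
  solution eqs []          = var
  solution eqs (false ∷ S) = solution (eqs ∘ Fin.suc) S
  solution eqs (true ∷ S)  = σ ⨾ mgu (bind s σ) (bind t σ)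
    where
    σ = solution (eqs ∘ Fin.suc) S
    s = proj₁ (eqs Fin.zero)
    t = proj₂ (eqs Fin.zero)

  Entails : ∀ {k} → (Fin k → Equation n m) → Subset k → Subset k → Set
  Entails eqs S T = ∀ i → i Sub.∈ T → bind (proj₁ (eqs i)) (solution eqs S) ≡ bind (proj₂ (eqs i)) (solution eqs S)

  entails? : ∀ {k} (eqs : Fin k → Equation n m) S T → Dec (Entails eqs S T)
  entails? eqs S T = all? λ i → (i ∈? T) →-dec (bind (proj₁ (eqs i)) (solution eqs S) ≟ᵗ bind (proj₂ (eqs i)) (solution eqs S))

  roots : Substitution n m → List (Fin n)
  roots σ = List.filter (λ r → σ r ≟ᵗ var r) (allFin n)

δ : ∀ {n} → Fin n → Point n
δ i k = if ⌊ k Fin.≟ i ⌋ then 1ℚ else 0ℚ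

δ-same : ∀ {n} (i : Fin n) → δ i i ≡ 1ℚ
δ-same i with i Fin.≟ i
... | yes _   = refl
... | no  i≢i = contradiction refl i≢i

δ-diff : ∀ {n} {i k : Fin n} → k ≢ i → δ i k ≡ 0ℚ
δ-diff {i = i} {k} k≢i with k Fin.≟ i
... | yes k≡i = contradiction k≡i k≢i
... | no  _   = refl

-- Terms as linear forms: correctness of unification, and bases of solution spaces

module Evaluation {n m : ℕ} (a : Fin m → ℕ) (a≢0 : ∀ l → a l ≢ 0) (indep : MultIndep a) where

  eval : Term n m → Point n → ℚ
  eval nothing        x = 0ℚ
  eval (just (i , g)) x = monomial a g ℚ.* x i

  apply : Substitution n m → Point n → Point n
  apply σ x i = eval (σ i) x

  eval-var : ∀ i x → eval (var i) x ≡ x i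
  eval-var i x = trans (cong (ℚ._* x i) (monomial-𝟘 a)) (ℚ.*-identityˡ (x i))

  eval-cong : ∀ t {x y} → (∀ i → x i ≡ y i) → eval t x ≡ eval t y
  eval-cong nothing        eq = refl
  eval-cong (just (i , g)) eq = cong (monomial a g ℚ.*_) (eq i)

  eval-scale : ∀ g t x → eval (scale g t) x ≡ monomial a g ℚ.* eval t x
  eval-scale g nothing        x = sym (ℚ.*-zeroʳ (monomial a g))
  eval-scale g (just (i , h)) x = trans
    (cong (ℚ._* x i) (monomial-⊕ a≢0 g h)) (ℚ.*-assoc (monomial a g) (monomial a h) (x i))

  eval-bind : ∀ t σ x → eval (bind t σ) x ≡ eval t (apply σ x)
  eval-bind nothing        σ x = refl
  eval-bind (just (i , g)) σ x = eval-scale g (σ i) x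

  eval-[:=]-same : ∀ r t x → apply [ r := t ] x r ≡ eval t x
  eval-[:=]-same r t x with r Fin.≟ r
  ... | yes _   = refl
  ... | no  r≢r = contradiction refl r≢r

  eval-[:=]-diff : ∀ {r k} t x → k ≢ r → apply [ r := t ] x k ≡ x k
  eval-[:=]-diff {r} {k} t x k≢r with k Fin.≟ r
  ... | yes k≡r = contradiction k≡r k≢r
  ... | no  _   = eval-var k x

  eval-[:=]-fixed : ∀ r t x → x r ≡ eval t x → ∀ k → apply [ r := t ] x k ≡ x k
  eval-[:=]-fixed r t x eq k with k Fin.≟ r
  ... | yes refl = sym eq
  ... | no  _    = eval-var k x

  monomial*δ≢0 : ∀ g (i : Fin n) → monomial a g ℚ.* δ i i ≢ 0ℚ
  monomial*δ≢0 g i eq = monomial≢0 a≢0 g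
    (trans (sym (trans (cong (monomial a g ℚ.*_) (δ-same i)) (ℚ.*-identityʳ (monomial a g)))) eq)

  -- Standard basis points separate terms: at `δ i` a term in xᵢ is nonzero, while 0 and terms in
  -- other variables vanish. With equal variables, what remains is an equality of coefficients.
  eval-injective : ∀ s t → (∀ x → eval s x ≡ eval t x) → s ≡ t
  eval-injective nothing        nothing        eq = refl
  eval-injective nothing        (just (i , g)) eq = contradiction (sym (eq (δ i))) (monomial*δ≢0 g i)
  eval-injective (just (i , g)) nothing        eq = contradiction (eq (δ i)) (monomial*δ≢0 g i)
  eval-injective (just (i , g)) (just (j , h)) eq with i Fin.≟ j
  ... | yes refl = cong (λ e → just (i , e)) (monomial-injective a≢0 indep g h (begin
    monomial a g             ≡⟨ ℚ.*-identityʳ (monomial a g) ⟨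
    monomial a g ℚ.* 1ℚ      ≡⟨ cong (monomial a g ℚ.*_) (δ-same i) ⟨
    monomial a g ℚ.* δ i i   ≡⟨ eq (δ i) ⟩
    monomial a h ℚ.* δ i i   ≡⟨ cong (monomial a h ℚ.*_) (δ-same i) ⟩
    monomial a h ℚ.* 1ℚ      ≡⟨ ℚ.*-identityʳ (monomial a h) ⟩
    monomial a h             ∎))
    where open ≡-Reasoning
  ... | no  i≢j  = contradiction (begin
    monomial a g ℚ.* δ i i   ≡⟨ eq (δ i) ⟩
    monomial a h ℚ.* δ i j   ≡⟨ cong (monomial a h ℚ.*_) (δ-diff (i≢j ∘ sym)) ⟩
    monomial a h ℚ.* 0ℚ      ≡⟨ ℚ.*-zeroʳ (monomial a h) ⟩
    0ℚ                       ∎) (monomial*δ≢0 g i)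
    where open ≡-Reasoning

  monomial-ratio : ∀ g h y → monomial a g ℚ.* (monomial a (⊖ g ⊕ h) ℚ.* y) ≡ monomial a h ℚ.* y
  monomial-ratio g h y = begin
    G ℚ.* (monomial a (⊖ g ⊕ h) ℚ.* y)   ≡⟨ cong (λ z → G ℚ.* (z ℚ.* y)) (monomial-⊕ a≢0 (⊖ g) h) ⟩
    G ℚ.* (G⁻¹ ℚ.* H ℚ.* y)              ≡⟨ solve 4 (λ G I H y → G :* (I :* H :* y) := I :* G :* (H :* y)) refl G G⁻¹ H y ⟩
    G⁻¹ ℚ.* G ℚ.* (H ℚ.* y)              ≡⟨ cong (ℚ._* (H ℚ.* y)) (monomial-⊖ a≢0 g) ⟩
    1ℚ ℚ.* (H ℚ.* y)                     ≡⟨ ℚ.*-identityˡ (H ℚ.* y) ⟩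
    H ℚ.* y                              ∎
    where
    open ≡-Reasoning
    open ℚ-Solver
    G   = monomial a g
    G⁻¹ = monomial a (⊖ g)
    H   = monomial a h

  mgu-unifies : ∀ s t y → eval s (apply (mgu s t) y) ≡ eval t (apply (mgu s t) y)
  mgu-unifies nothing        nothing        y = refl
  mgu-unifies nothing        (just (r , g)) y =
    sym (trans (cong (monomial a g ℚ.*_) (eval-[:=]-same r nothing y)) (ℚ.*-zeroʳ (monomial a g)))
  mgu-unifies (just (r , g)) nothing        y =
    trans (cong (monomial a g ℚ.*_) (eval-[:=]-same r nothing y)) (ℚ.*-zeroʳ (monomial a g))
  mgu-unifies (just (r , g)) (just (r′ , h)) y with r Fin.≟ r′ | g ≟ᵉ h
  ... | no r≢r′ | _ = begin
    monomial a g ℚ.* apply [ r := t ] y r              ≡⟨ cong (monomial a g ℚ.*_) (eval-[:=]-same r t y) ⟩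
    monomial a g ℚ.* (monomial a (⊖ g ⊕ h) ℚ.* y r′)   ≡⟨ monomial-ratio g h (y r′) ⟩
    monomial a h ℚ.* y r′                              ≡⟨ cong (monomial a h ℚ.*_) (eval-[:=]-diff t y (r≢r′ ∘ sym)) ⟨
    monomial a h ℚ.* apply [ r := t ] y r′             ∎
    where
    open ≡-Reasoning
    t = just (r′ , ⊖ g ⊕ h)
  ... | yes refl | yes refl = refl
  ... | yes refl | no  _    = trans (vanishes g) (sym (vanishes h))
    where
    vanishes : ∀ e → monomial a e ℚ.* apply [ r := nothing ] y r ≡ 0ℚ
    vanishes e = trans (cong (monomial a e ℚ.*_) (eval-[:=]-same r nothing y)) (ℚ.*-zeroʳ (monomial a e))

  -- A solution already satisfies the assignment that `mgu` makes, so substituting changes nothing.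
  -- With `mgu-unifies` this makes `apply (mgu s t)` a projection onto the solutions of the
  -- equation.
  mgu-fixes : ∀ s t x → eval s x ≡ eval t x → ∀ k → apply (mgu s t) x k ≡ x k
  mgu-fixes nothing        nothing         x eq k = eval-var k x
  mgu-fixes nothing        (just (r , g))  x eq = eval-[:=]-fixed r nothing x (*-cancel-0 (monomial≢0 a≢0 g) (sym eq))
  mgu-fixes (just (r , g)) nothing         x eq = eval-[:=]-fixed r nothing x (*-cancel-0 (monomial≢0 a≢0 g) eq)
  mgu-fixes (just (r , g)) (just (r′ , h)) x eq k with r Fin.≟ r′ | g ≟ᵉ h
  ... | no  _    | _       = eval-[:=]-fixed r (just (r′ , ⊖ g ⊕ h)) x
    (*-cancelˡ (monomial≢0 a≢0 g) (trans eq (sym (monomial-ratio g h (x r′))))) k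
  ... | yes refl | yes _   = eval-var k x
  ... | yes refl | no  g≢h with x r ℚ.≟ 0ℚ
  ...   | yes xr≡0 = eval-[:=]-fixed r nothing x xr≡0 k
  -- A nonzero xᵣ could be cancelled, giving equal monomials and hence equal exponents.
  ...   | no  xr≢0 = contradiction (monomial-injective a≢0 indep g h (*-cancelˡ xr≢0 (begin
    x r ℚ.* monomial a g   ≡⟨ ℚ.*-comm (x r) (monomial a g) ⟩
    monomial a g ℚ.* x r   ≡⟨ eq ⟩
    monomial a h ℚ.* x r   ≡⟨ ℚ.*-comm (monomial a h) (x r) ⟩
    x r ℚ.* monomial a h   ∎))) g≢h
    where open ≡-Reasoning

  Holds : ∀ {k} → (Fin k → Equation n m) → Subset k → Point n → Set
  Holds eqs S x = ∀ i → i Sub.∈ S → eval (proj₁ (eqs i)) x ≡ eval (proj₂ (eqs i)) x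

  -- Substitution acts contravariantly: `σ` comes first on terms, `τ` first on points.
  apply-⨾ : ∀ σ τ y i → apply (σ ⨾ τ) y i ≡ apply σ (apply τ y) i
  apply-⨾ σ τ y i = eval-bind (σ i) τ y

  -- Every point of the image of `apply σ` satisfies the tail equations, so feeding it `apply τ y`
  -- instead of `y` cannot spoil them, while `τ` unifies the head equation as rewritten by `σ`.
  solution-holds : ∀ {k} (eqs : Fin k → Equation n m) S y → Holds eqs S (apply (solution eqs S) y)
  solution-holds eqs (false ∷ S) y (Fin.suc i) (there i∈S) = solution-holds (eqs ∘ Fin.suc) S y i i∈S
  solution-holds eqs (true ∷ S)  y i i∈S = begin
    eval (proj₁ (eqs i)) (apply (σ ⨾ τ) y)      ≡⟨ eval-cong (proj₁ (eqs i)) (apply-⨾ σ τ y) ⟩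
    eval (proj₁ (eqs i)) (apply σ (apply τ y))  ≡⟨ holds i i∈S ⟩
    eval (proj₂ (eqs i)) (apply σ (apply τ y))  ≡⟨ eval-cong (proj₂ (eqs i)) (apply-⨾ σ τ y) ⟨
    eval (proj₂ (eqs i)) (apply (σ ⨾ τ) y)      ∎
    where
    open ≡-Reasoning
    σ = solution (eqs ∘ Fin.suc) S
    s = proj₁ (eqs Fin.zero)
    t = proj₂ (eqs Fin.zero)
    τ = mgu (bind s σ) (bind t σ)

    holds : Holds eqs (true ∷ S) (apply σ (apply τ y))
    holds Fin.zero    _           = begin
      eval s (apply σ (apply τ y)) ≡⟨ eval-bind s σ (apply τ y) ⟨
      eval (bind s σ) (apply τ y)  ≡⟨ mgu-unifies (bind s σ) (bind t σ) y ⟩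
      eval (bind t σ) (apply τ y)  ≡⟨ eval-bind t σ (apply τ y) ⟩
      eval t (apply σ (apply τ y)) ∎
    holds (Fin.suc i) (there i∈S) = solution-holds (eqs ∘ Fin.suc) S (apply τ y) i i∈S

  -- By induction `x` is fixed by the solution of the tail, so rewriting the head equation does not
  -- affect its truth at `x`, and `mgu-fixes` applies.
  solution-fixes : ∀ {k} (eqs : Fin k → Equation n m) S x → Holds eqs S x → ∀ i → apply (solution eqs S) x i ≡ x i
  solution-fixes eqs []          x hx i = eval-var i x
  solution-fixes eqs (false ∷ S) x hx i = solution-fixes (eqs ∘ Fin.suc) S x (λ j → hx (Fin.suc j) ∘ there) i
  solution-fixes eqs (true ∷ S)  x hx i = begin
    apply (σ ⨾ τ) x i        ≡⟨ apply-⨾ σ τ x i ⟩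
    apply σ (apply τ x) i    ≡⟨ eval-cong (σ i) (mgu-fixes (bind s σ) (bind t σ) x unified) ⟩
    apply σ x i              ≡⟨ fixed i ⟩
    x i                      ∎
    where
    open ≡-Reasoning
    σ = solution (eqs ∘ Fin.suc) S
    s = proj₁ (eqs Fin.zero)
    t = proj₂ (eqs Fin.zero)
    τ = mgu (bind s σ) (bind t σ)

    fixed : ∀ i → apply σ x i ≡ x i
    fixed = solution-fixes (eqs ∘ Fin.suc) S x λ j → hx (Fin.suc j) ∘ there

    unified : eval (bind s σ) x ≡ eval (bind t σ) x
    unified = begin
      eval (bind s σ) x    ≡⟨ eval-bind s σ x ⟩
      eval s (apply σ x)   ≡⟨ eval-cong s fixed ⟩
      eval s x             ≡⟨ hx Fin.zero here ⟩
      eval t x             ≡⟨ eval-cong t fixed ⟨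
      eval t (apply σ x)   ≡⟨ eval-bind t σ x ⟨
      eval (bind t σ) x    ∎

  module _ {k} (eqs : Fin k → Equation n m) where

    -- The point `apply σ y` solves `S` for every `y`, so each equation of `T`, once substituted,
    -- holds identically in `y`; then its two sides are the same term.
    holds⇒entails : ∀ S T → (∀ x → Holds eqs S x → Holds eqs T x) → Entails eqs S T
    holds⇒entails S T S⊆T i i∈T = eval-injective (bind s σ) (bind t σ) λ y → begin
      eval (bind s σ) y    ≡⟨ eval-bind s σ y ⟩
      eval s (apply σ y)   ≡⟨ S⊆T (apply σ y) (solution-holds eqs S y) i i∈T ⟩
      eval t (apply σ y)   ≡⟨ eval-bind t σ y ⟨
      eval (bind t σ) y    ∎
      where
      open ≡-Reasoning
      σ = solution eqs S
      s = proj₁ (eqs i)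
      t = proj₂ (eqs i)

    entails⇒holds : ∀ S T → Entails eqs S T → ∀ x → Holds eqs S x → Holds eqs T x
    entails⇒holds S T S⊢T x hx i i∈T = begin
      eval s x             ≡⟨ eval-cong s (solution-fixes eqs S x hx) ⟨
      eval s (apply σ x)   ≡⟨ eval-bind s σ x ⟨
      eval (bind s σ) x    ≡⟨ cong (λ u → eval u x) (S⊢T i i∈T) ⟩
      eval (bind t σ) x    ≡⟨ eval-bind t σ x ⟩
      eval t (apply σ x)   ≡⟨ eval-cong t (solution-fixes eqs S x hx) ⟩
      eval t x             ∎
      where
      open ≡-Reasoning
      σ = solution eqs S
      s = proj₁ (eqs i)
      t = proj₂ (eqs i)

    -- The fixed variables are free parameters. Setting one of them to 1 and all other variables to
    -- 0 before applying `σ` gives a basis, and the coordinates of a solution are its values at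
    -- these variables.
    holds-dim : ∀ S → HasDim (Holds eqs S) (List.length (roots (solution eqs S)))
    holds-dim S = b , (λ j → solution-holds eqs S (δ (root j))) , independent , λ x hx → (x ∘ root) , spans x hx
      where
      open ≡-Reasoning
      σ = solution eqs S
      R = roots σ

      root : Fin (List.length R) → Fin n
      root = List.lookup R

      b : Fin (List.length R) → Point n
      b j = apply σ (δ (root j))

      root-injective : ∀ {i j} → i ≢ j → root i ≢ root j
      root-injective {i} {j} = AllPairs-lookup (_∘ sym) (Unique.filter⁺ (λ r → σ r ≟ᵗ var r) (Unique.allFin⁺ n)) i j

      σ-root : ∀ j → σ (root j) ≡ var (root j)
      σ-root j = proj₂ (∈-filter⁻ (λ r → σ r ≟ᵗ var r) {xs = allFin n} (∈-lookup {xs = R} j))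

      b-root : ∀ i j → b i (root j) ≡ δ (root i) (root j)
      b-root i j = trans (cong (λ t → eval t (δ (root i))) (σ-root j)) (eval-var (root j) (δ (root i)))

      independent : Independent b
      independent λs eq j = begin
        λs j                    ≡⟨ ℚ.*-identityʳ (λs j) ⟨
        λs j ℚ.* 1ℚ             ≡⟨ cong (λs j ℚ.*_) (trans (b-root j j) (δ-same (root j))) ⟨
        λs j ℚ.* b j (root j)   ≡⟨ sumℚ-single (λ i → λs i ℚ.* b i (root j)) j (λ i i≢j → trans
                                     (cong (λs i ℚ.*_) (trans (b-root i j) (δ-diff (root-injective i≢j ∘ sym))))
                                     (ℚ.*-zeroʳ (λs i))) ⟨
        lincomb λs b (root j)   ≡⟨ eq (root j) ⟩
        0ℚ                      ∎

      -- `apply σ` is idempotent, since its image consists of solutions and solutions are fixed.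
      -- Reading this at coordinate `i` and cancelling a^g shows that `σ` fixes any variable
      -- occurring in its values.
      root-of : ∀ i {r g} → σ i ≡ just (r , g) → σ r ≡ var r
      root-of i {r} {g} σi = eval-injective (σ r) (var r) λ y → *-cancelˡ (monomial≢0 a≢0 g) (begin
        monomial a g ℚ.* eval (σ r) y      ≡⟨ cong (λ t → eval t (apply σ y)) σi ⟨
        apply σ (apply σ y) i              ≡⟨ solution-fixes eqs S (apply σ y) (solution-holds eqs S y) i ⟩
        apply σ y i                        ≡⟨ cong (λ t → eval t y) σi ⟩
        monomial a g ℚ.* y r               ≡⟨ cong (monomial a g ℚ.*_) (eval-var r y) ⟨
        monomial a g ℚ.* eval (var r) y    ∎)

      spans : ∀ x → Holds eqs S x → ∀ i → x i ≡ lincomb (x ∘ root) b i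
      spans x hx i = trans (sym (solution-fixes eqs S x hx i)) combination
        where
        combination : apply σ x i ≡ sumℚ (λ j → x (root j) ℚ.* b j i)
        combination with σ i in σi
        ... | nothing      = sym (sumℚ-zero λ j → ℚ.*-zeroʳ (x (root j)))
        ... | just (r , g) = sym (begin
          sumℚ (λ j → x (root j) ℚ.* (monomial a g ℚ.* δ (root j) r))
            ≡⟨ sumℚ-single (λ j → x (root j) ℚ.* (monomial a g ℚ.* δ (root j) r)) p vanishes ⟩
          x (root p) ℚ.* (monomial a g ℚ.* δ (root p) r)
            ≡⟨ cong (λ q → x q ℚ.* (monomial a g ℚ.* δ q r)) r≡root ⟨
          x r ℚ.* (monomial a g ℚ.* δ r r)
            ≡⟨ cong (λ z → x r ℚ.* (monomial a g ℚ.* z)) (δ-same r) ⟩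
          x r ℚ.* (monomial a g ℚ.* 1ℚ)
            ≡⟨ cong (x r ℚ.*_) (ℚ.*-identityʳ (monomial a g)) ⟩
          x r ℚ.* monomial a g
            ≡⟨ ℚ.*-comm (x r) (monomial a g) ⟩
          monomial a g ℚ.* x r
            ∎)
          where
          r∈R : r ∈ R
          r∈R = ∈-filter⁺ (λ r → σ r ≟ᵗ var r) (∈-allFin r) (root-of i σi)

          p : Fin (List.length R)
          p = Any.index r∈R

          r≡root : r ≡ root p
          r≡root = Any.lookup-index r∈R

          vanishes : ∀ j → j ≢ p → x (root j) ℚ.* (monomial a g ℚ.* δ (root j) r) ≡ 0ℚ
          vanishes j j≢p = begin
            x (root j) ℚ.* (monomial a g ℚ.* δ (root j) r)   ≡⟨ cong (λ z → x (root j) ℚ.* (monomial a g ℚ.* z)) (δ-diff λ r≡rj → root-injective j≢p (trans (sym r≡rj) r≡root)) ⟩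
            x (root j) ℚ.* (monomial a g ℚ.* 0ℚ)             ≡⟨ cong (x (root j) ℚ.*_) (ℚ.*-zeroʳ (monomial a g)) ⟩
            x (root j) ℚ.* 0ℚ                                ≡⟨ ℚ.*-zeroʳ (x (root j)) ⟩
            0ℚ                                               ∎

-- The arrangements 𝒜ₙ(a)

HasDim-resp : ∀ {n d} {P Q : Point n → Set} → (∀ x → P x → Q x) → (∀ x → Q x → P x) → HasDim P d → HasDim Q d
HasDim-resp P⊆Q Q⊆P (b , b∈ , indep , span) = b , (λ j → P⊆Q (b j) (b∈ j)) , indep , λ x → span x ∘ Q⊆P x

-- `CharPolyData` consults the hyperplanes only through inclusions between flats and their
-- dimensions, so all the other fields are reused as they are.
charPoly-transfer : ∀ {n k} {h h′ : Fin k → Normal n} {p} →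
  (∀ S T → _⊆F_ {A = arr k h} S T → _⊆F_ {A = arr k h′} S T) →
  (∀ S T → _⊆F_ {A = arr k h′} S T → _⊆F_ {A = arr k h} S T) →
  (∀ S {d} → HasDim (Flat (arr k h) S) d → HasDim (Flat (arr k h′) S) d) →
  CharPolyData (arr k h) p → CharPolyData (arr k h′) p
charPoly-transfer to from dims D = record
  { r        = r
  ; F        = F
  ; complete = λ S → proj₁ (complete S) , to S _ (proj₁ (proj₂ (complete S))) , to _ S (proj₂ (proj₂ (complete S)))
  ; distinct = λ i j (i⊑j , j⊑i) → distinct i j (from _ _ i⊑j , from _ _ j⊑i)
  ; le       = le
  ; le-spec₁ = λ i j i≤j → to _ _ (le-spec₁ i j i≤j)
  ; le-spec₂ = λ i j j⊑i → le-spec₂ i j (from _ _ j⊑i)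
  ; μ        = μ
  ; μ-bot    = λ j (j⊑⊥ , ⊥⊑j) → μ-bot j (from _ _ j⊑⊥ , from _ _ ⊥⊑j)
  ; μ-rec    = λ j Fj≉⊥ → μ-rec j λ (j⊑⊥ , ⊥⊑j) → Fj≉⊥ (to _ _ j⊑⊥ , to _ _ ⊥⊑j)
  ; dim      = dim
  ; dim-spec = λ j → dims (F j) (dim-spec j)
  ; coeff    = coeff
  }
  where open CharPolyData D

charPoly-resp-flats : ∀ {n k} {h h′ : Fin k → Normal n} {p} →
  (∀ S x → Flat (arr k h) S x → Flat (arr k h′) S x) →
  (∀ S x → Flat (arr k h′) S x → Flat (arr k h) S x) →
  CharPolyData (arr k h) p → CharPolyData (arr k h′) p
charPoly-resp-flats to from = charPoly-transfer
  (λ S T S⊑T x → to T x ∘ S⊑T x ∘ from S x)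
  (λ S T S⊑T x → from T x ∘ S⊑T x ∘ to S x)
  (λ S → HasDim-resp (to S) (from S))

-- Index sets given by lengths of different lists are equal only propositionally; this moves data
-- across such an equality.
charPoly-cast : ∀ {n k k′} (k≡k′ : k ≡ k′) {h : Fin k → Normal n} {h′ : Fin k′ → Normal n} {p} →
  (∀ i → h i ≡ h′ (Fin.cast k≡k′ i)) → CharPolyData (arr k h) p → CharPolyData (arr k′ h′) p
charPoly-cast refl {h} {h′} eq = charPoly-resp-flats
  (λ S x hx i i∈S → trans (cong (λ c → dot c x) (sym (h≗h′ i))) (hx i i∈S))
  (λ S x hx i i∈S → trans (cong (λ c → dot c x) (h≗h′ i)) (hx i i∈S))
  where
  h≗h′ : ∀ i → h i ≡ h′ i
  h≗h′ i = trans (eq i) (cong h′ (cast-is-id refl i))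

lookup-map : ∀ {A B : Set} (f : A → B) (xs : List A) i →
  List.lookup (map f xs) i ≡ f (List.lookup xs (Fin.cast (List.length-map f xs) i))
lookup-map f (x ∷ xs) Fin.zero    = refl
lookup-map f (x ∷ xs) (Fin.suc i) = lookup-map f xs i

ℤ→ℚ-unit-same : ∀ {n} (i : Fin n) → ℤ→ℚ (unit i i) ≡ 1ℚ
ℤ→ℚ-unit-same i with i Fin.≟ i
... | yes _   = refl
... | no  i≢i = contradiction refl i≢i

ℤ→ℚ-unit-diff : ∀ {n} {i k : Fin n} → k ≢ i → ℤ→ℚ (unit i k) ≡ 0ℚ
ℤ→ℚ-unit-diff {i = i} {k} k≢i with k Fin.≟ i
... | yes k≡i = contradiction k≡i k≢i
... | no  _   = refl

dot-unit : ∀ {n} (i : Fin n) x → dot (unit i) x ≡ x i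
dot-unit i x = begin
  dot (unit i) x               ≡⟨ sumℚ-single (λ k → ℤ→ℚ (unit i k) ℚ.* x k) i
                                    (λ k k≢i → trans (cong (ℚ._* x k) (ℤ→ℚ-unit-diff k≢i)) (ℚ.*-zeroˡ (x k))) ⟩
  ℤ→ℚ (unit i i) ℚ.* x i       ≡⟨ cong (ℚ._* x i) (ℤ→ℚ-unit-same i) ⟩
  1ℚ ℚ.* x i                   ≡⟨ ℚ.*-identityˡ (x i) ⟩
  x i                          ∎
  where open ≡-Reasoning

dot-diffN : ∀ {n} (i : Fin n) c j x → dot (diffN i c j) x ≡ x i ℚ.- ℤ→ℚ c ℚ.* x j
dot-diffN i c j x = begin
  dot (diffN i c j) x
    ≡⟨ sumℚ-cong (λ k → trans (cong (ℚ._* x k) (coefficient k)) (distribute (ℤ→ℚ (unit i k)) (ℤ→ℚ c) (ℤ→ℚ (unit j k)) (x k))) ⟩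
  sumℚ (λ k → ℤ→ℚ (unit i k) ℚ.* x k ℚ.+ ℚ.- ℤ→ℚ c ℚ.* (ℤ→ℚ (unit j k) ℚ.* x k))
    ≡⟨ sumℚ-+ (λ k → ℤ→ℚ (unit i k) ℚ.* x k) (λ k → ℚ.- ℤ→ℚ c ℚ.* (ℤ→ℚ (unit j k) ℚ.* x k)) ⟩
  dot (unit i) x ℚ.+ sumℚ (λ k → ℚ.- ℤ→ℚ c ℚ.* (ℤ→ℚ (unit j k) ℚ.* x k))
    ≡⟨ cong (dot (unit i) x ℚ.+_) (sumℚ-*ˡ (λ k → ℤ→ℚ (unit j k) ℚ.* x k) (ℚ.- ℤ→ℚ c)) ⟨
  dot (unit i) x ℚ.+ ℚ.- ℤ→ℚ c ℚ.* dot (unit j) x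
    ≡⟨ cong₂ (λ y z → y ℚ.+ ℚ.- ℤ→ℚ c ℚ.* z) (dot-unit i x) (dot-unit j x) ⟩
  x i ℚ.+ ℚ.- ℤ→ℚ c ℚ.* x j
    ≡⟨ cong (x i ℚ.+_) (ℚ.neg-distribˡ-* (ℤ→ℚ c) (x j)) ⟨
  x i ℚ.- ℤ→ℚ c ℚ.* x j
    ∎
  where
  open ≡-Reasoning
  coefficient : ∀ k → ℤ→ℚ (diffN i c j k) ≡ ℤ→ℚ (unit i k) ℚ.- ℤ→ℚ c ℚ.* ℤ→ℚ (unit j k)
  coefficient k = begin
    ℤ→ℚ (unit i k ℤ.- c ℤ.* unit j k)               ≡⟨ ℤ→ℚ-+ (unit i k) (ℤ.- (c ℤ.* unit j k)) ⟩
    ℤ→ℚ (unit i k) ℚ.+ ℤ→ℚ (ℤ.- (c ℤ.* unit j k))   ≡⟨ cong (ℤ→ℚ (unit i k) ℚ.+_) (ℤ→ℚ-neg (c ℤ.* unit j k)) ⟩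
    ℤ→ℚ (unit i k) ℚ.- ℤ→ℚ (c ℤ.* unit j k)         ≡⟨ cong (λ z → ℤ→ℚ (unit i k) ℚ.- z) (ℤ→ℚ-* c (unit j k)) ⟩
    ℤ→ℚ (unit i k) ℚ.- ℤ→ℚ c ℚ.* ℤ→ℚ (unit j k)     ∎

  distribute : ∀ u c v x → (u ℚ.- c ℚ.* v) ℚ.* x ≡ u ℚ.* x ℚ.+ ℚ.- c ℚ.* (v ℚ.* x)
  distribute = ℚ-Solver.solve 4 (λ u c v x → (u :- c :* v) :* x := u :* x :+ :- c :* (v :* x)) refl
    where open ℚ-Solver

-- ratio i nothing j stands for xᵢ = xⱼ and ratio i (just l) j for xᵢ = aₗ xⱼ.
data Hyperplane (n m : ℕ) : Set where
  coord : Fin n → Hyperplane n m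
  ratio : Fin n → Maybe (Fin m) → Fin n → Hyperplane n m

-- Built block by block like `hypList`, with `aₗ` replaced by its index `l`, so that the list does
-- not depend on the family.
hyperplanes : ∀ n m → List (Hyperplane n m)
hyperplanes n m =
     map coord (allFin n)
  ++ concatMap (λ i → concatMap (λ j →
       (if ⌊ i Fin.<? j ⌋ then ratio i nothing j ∷ [] else [])) (allFin n)) (allFin n)
  ++ concatMap (λ i → concatMap (λ j →
       (if ⌊ i Fin.≟ j ⌋ then [] else map (λ l → ratio i (just l) j) (allFin m))) (allFin n)) (allFin n)

normal : ∀ {n m} → (Fin m → ℕ) → Hyperplane n m → Normal n
normal a (coord i)            = unit i
normal a (ratio i nothing j)  = diffN i (+ 1) j
normal a (ratio i (just l) j) = diffN i (+ a l) j

hypList-map : ∀ {m} n (a : Fin m → ℕ) → hypList n a ≡ map (normal a) (hyperplanes n m)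
hypList-map {m} n a = sym (begin
  map f (map coord (allFin n) ++ concatMap E (allFin n) ++ concatMap G (allFin n))
    ≡⟨ List.map-++ f (map coord (allFin n)) (concatMap E (allFin n) ++ concatMap G (allFin n)) ⟩
  map f (map coord (allFin n)) ++ map f (concatMap E (allFin n) ++ concatMap G (allFin n))
    ≡⟨ cong (map f (map coord (allFin n)) ++_) (List.map-++ f (concatMap E (allFin n)) (concatMap G (allFin n))) ⟩
  map f (map coord (allFin n)) ++ map f (concatMap E (allFin n)) ++ map f (concatMap G (allFin n))
    ≡⟨ cong₂ _++_ (sym (List.map-∘ (allFin n))) (cong₂ _++_
         (map-concatMap₂ (λ i j → map-if ⌊ i Fin.<? j ⌋ refl refl))
         (map-concatMap₂ (λ i j → map-if ⌊ i Fin.≟ j ⌋ refl (sym (List.map-∘ (allFin m)))))) ⟩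
  hypList n a
    ∎)
  where
  open ≡-Reasoning
  f : Hyperplane n m → Normal n
  f = normal a

  e g : Fin n → Fin n → List (Hyperplane n m)
  e i j = if ⌊ i Fin.<? j ⌋ then ratio i nothing j ∷ [] else []
  g i j = if ⌊ i Fin.≟ j ⌋ then [] else map (λ l → ratio i (just l) j) (allFin m)

  E G : Fin n → List (Hyperplane n m)
  E i = concatMap (e i) (allFin n)
  G i = concatMap (g i) (allFin n)

  map-if : ∀ b {xs ys : List (Hyperplane n m)} {us vs} → map f xs ≡ us → map f ys ≡ vs →
    map f (if b then xs else ys) ≡ (if b then us else vs)
  map-if true  eq _  = eq
  map-if false _  eq = eq

  map-concatMap₂ : {u : Fin n → Fin n → List (Hyperplane n m)} {v : Fin n → Fin n → List (Normal n)} →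
    (∀ i j → map f (u i j) ≡ v i j) →
    map f (concatMap (λ i → concatMap (u i) (allFin n)) (allFin n)) ≡
    concatMap (λ i → concatMap (v i) (allFin n)) (allFin n)
  map-concatMap₂ {u} eq = trans (List.map-concatMap f (λ i → concatMap (u i) (allFin n)) (allFin n))
    (List.concatMap-cong (λ i → trans (List.map-concatMap f (u i) (allFin n))
      (List.concatMap-cong (eq i) (allFin n))) (allFin n))

equation : ∀ {n m} → Hyperplane n m → Equation n m
equation (coord i)            = var i , nothing
equation (ratio i nothing j)  = var i , var j
equation (ratio i (just l) j) = var i , just (j , basis l)

-- Flats as solution sets of symbolic equations, and passage between families

module _ {m : ℕ} (n : ℕ) where

  H : Fin (List.length (hyperplanes n m)) → Hyperplane n m
  H = List.lookup (hyperplanes n m)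

  eqs : Fin (List.length (hyperplanes n m)) → Equation n m
  eqs = equation ∘ H

  arrangement : (Fin m → ℕ) → Arrangement n
  arrangement a = arr (List.length (hyperplanes n m)) (normal a ∘ H)

  module _ (a : Fin m → ℕ) {p : ℕ → ℤ} where

    to-arrangement : CharPolyData (𝒜 n a) p → CharPolyData (arrangement a) p
    to-arrangement D = charPoly-cast (List.length-map (normal a) (hyperplanes n m)) (lookup-map (normal a) (hyperplanes n m))
      (subst (λ L → CharPolyData (arr (List.length L) (List.lookup L)) p) (hypList-map n a) D)

    from-arrangement : CharPolyData (arrangement a) p → CharPolyData (𝒜 n a) p
    from-arrangement D = subst (λ L → CharPolyData (arr (List.length L) (List.lookup L)) p) (sym (hypList-map n a))
      (charPoly-cast (sym length-eq) eq D)
      where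
      length-eq = List.length-map (normal a) (hyperplanes n m)
      eq : ∀ i → normal a (H i) ≡ List.lookup (map (normal a) (hyperplanes n m)) (Fin.cast (sym length-eq) i)
      eq i = sym (trans (lookup-map (normal a) (hyperplanes n m) (Fin.cast (sym length-eq) i))
        (cong (normal a ∘ H) (cast-involutive length-eq (sym length-eq) i)))

  module _ (a : Fin m → ℕ) (a≢0 : ∀ l → a l ≢ 0) (indep : MultIndep a) where
    open Evaluation {n} a a≢0 indep
    open IntersectionPoset (arrangement a) using (_⊑_)

    dot-normal : ∀ h x → dot (normal a h) x ≡ eval (proj₁ (equation h)) x ℚ.- eval (proj₂ (equation h)) x
    dot-normal (coord i) x = trans (dot-unit i x) (trans (sym (eval-var i x)) (sym (ℚ.+-identityʳ (eval (var i) x))))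
    dot-normal (ratio i nothing j) x = trans (dot-diffN i (+ 1) j x)
      (cong₂ ℚ._-_ (sym (eval-var i x)) (cong (ℚ._* x j) (sym (monomial-𝟘 a))))
    dot-normal (ratio i (just l) j) x = trans (dot-diffN i (+ a l) j x)
      (cong₂ ℚ._-_ (sym (eval-var i x)) (cong (ℚ._* x j) (sym (monomial-basis a l))))

    flat⇒holds : ∀ S x → Flat (arrangement a) S x → Holds eqs S x
    flat⇒holds S x hx i i∈S = begin
      u              ≡⟨ solve 2 (λ u v → u := (u :- v) :+ v) refl u v ⟩
      u ℚ.- v ℚ.+ v  ≡⟨ cong (ℚ._+ v) (trans (sym (dot-normal (H i) x)) (hx i i∈S)) ⟩
      0ℚ ℚ.+ v       ≡⟨ ℚ.+-identityˡ v ⟩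
      v              ∎
      where
      open ≡-Reasoning
      open ℚ-Solver
      u = eval (proj₁ (eqs i)) x
      v = eval (proj₂ (eqs i)) x

    holds⇒flat : ∀ S x → Holds eqs S x → Flat (arrangement a) S x
    holds⇒flat S x hx i i∈S = begin
      dot (normal a (H i)) x   ≡⟨ dot-normal (H i) x ⟩
      u ℚ.- v                  ≡⟨ cong (ℚ._- v) (hx i i∈S) ⟩
      v ℚ.- v                  ≡⟨ ℚ.+-inverseʳ v ⟩
      0ℚ                       ∎
      where
      open ≡-Reasoning
      u = eval (proj₁ (eqs i)) x
      v = eval (proj₂ (eqs i)) x

    ⊑⇒entails : ∀ S T → S ⊑ T → Entails eqs S T
    ⊑⇒entails S T S⊑T = holds⇒entails eqs S T λ x → flat⇒holds T x ∘ S⊑T x ∘ holds⇒flat S x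

    entails⇒⊑ : ∀ S T → Entails eqs S T → S ⊑ T
    entails⇒⊑ S T S⊢T x = holds⇒flat T x ∘ entails⇒holds eqs S T S⊢T x ∘ flat⇒holds S x

    flat-dim : ∀ S → HasDim (Flat (arrangement a) S) (List.length (roots (solution eqs S)))
    flat-dim S = HasDim-resp (holds⇒flat S) (flat⇒holds S) (holds-dim eqs S)

    arrangement-charPoly : Σ (ℕ → ℤ) (CharPolyData (arrangement a))
    arrangement-charPoly = IntersectionPoset.charPoly-exists (arrangement a)
      (λ S T → map′ (entails⇒⊑ S T) (⊑⇒entails S T) (entails? eqs S T))
      (λ S → _ , flat-dim S)

    𝒜-charPoly : Σ (ℕ → ℤ) (IsCharPoly (𝒜 n a))
    𝒜-charPoly = proj₁ arrangement-charPoly , from-arrangement a (proj₂ arrangement-charPoly)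

  arrangement-transfer : ∀ {a a′ : Fin m → ℕ} → (∀ l → a l ≢ 0) → (∀ l → a′ l ≢ 0) → MultIndep a → MultIndep a′ →
    ∀ {p} → CharPolyData (arrangement a) p → CharPolyData (arrangement a′) p
  arrangement-transfer {a} {a′} a≢0 a′≢0 indep indep′ = charPoly-transfer
    (λ S T → entails⇒⊑ a′ a′≢0 indep′ S T ∘ ⊑⇒entails a a≢0 indep S T)
    (λ S T → entails⇒⊑ a a≢0 indep S T ∘ ⊑⇒entails a′ a′≢0 indep′ S T)
    -- The dimension recorded in the data is arbitrary; `dim-unique` identifies it with the number
    -- of fixed variables, a count common to both families.
    (λ S D → subst (HasDim (Flat (arrangement a′) S)) (dim-unique (flat-dim a a≢0 indep S) D) (flat-dim a′ a′≢0 indep′ S))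

theorem2p1 : (m n : ℕ) → 1 ≤ m → 1 ≤ n →
    (a a′ : Fin m → ℕ) →
    (∀ l → 2 ≤ a l) → (∀ l → 2 ≤ a′ l) →
    MultIndep a → MultIndep a′ →
    Σ (ℕ → ℤ) (IsCharPoly (𝒜 n a))
    × Σ (ℕ → ℤ) (IsCharPoly (𝒜 n a′))
    × ((p p′ : ℕ → ℤ) → IsCharPoly (𝒜 n a) p → IsCharPoly (𝒜 n a′) p′ →
    ∀ e → p e ≡ p′ e)
theorem2p1 m n _ _ a a′ 2≤a 2≤a′ indep indep′ =
    𝒜-charPoly n a (≢0 2≤a) indep
  , 𝒜-charPoly n a′ (≢0 2≤a′) indep′
  -- Both data are brought to the symbolic arrangement of `a′`, where uniqueness for one arrangement
  -- applies.
  , λ p p′ D D′ → IntersectionPoset.charPoly-unique (arrangement n a′) (λ S → dim-unique)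
      (arrangement-transfer n (≢0 2≤a) (≢0 2≤a′) indep indep′ (to-arrangement n a D))
      (to-arrangement n a′ D′)
  where
  ≢0 : {b : Fin m → ℕ} → (∀ l → 2 ≤ b l) → ∀ l → b l ≢ 0
  ≢0 2≤b l bl≡0 with () ← subst (2 ≤_) bl≡0 (2≤b l)
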